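{- Let $m>3$. Promotion $\partial$ acting on $\mathrm{SYT}_R(1,m-2,1)$ has order $(m-1)(m-2)$, with exactly one orbit of size $m-2$ and $m-3$ orbits of size $m-1$. Consequently, with $\psi_m(q,t)=[m-2]_t+(m-3)[m-1]_q$, $\xi$ a primitive $(m-1)$-th root of unity and $\zeta$ a primitive $(m-2)$-th root of unity, for all integers $r,s$, \[ \psi_m(\xi^r,\zeta^s)=\#\{T\in\mathrm{SYT}_R(1,m-2,1):\partial^{r(m-2)+s(m-1)}(T)=T\}; \] i.e. $(\mathrm{SYT}_R(1,m-2,1),\langle\partial^{m-1}\rangle\times\langle\partial^{m-2}\rangle,\psi_m(q,t))$ exhibits the bicyclic sieving phenomenon.
   Context: $\mathrm{SYT}_R(1,m-2,1)$ is the set of standard Young tableaux with entries $1,\dots,m$ of the three-row ribbon shape consisting of a single box in the top row, $m-2$ boxes in the middle row and a single box in the bottom row, where the top box lies directly above the last box of the middle row and the bottom box lies directly below the first box of the middle row. Promotion $\partial$: replace $1$ by a dot; repeatedly swap the dot with the smaller of its right and lower neighbours in the shape until neither exists; decrement all entries by one and put $m$ in the dot's box. $[r]_q=1+q+\dots+q^{r-1}$. Bicyclic sieving for cyclic groups $\langle c_1\rangle,\langle c_2\rangle$ of orders $k_1,k_2$ acting on $X$ with polynomial $f(q,t)$ means $f(\zeta_1^i,\zeta_2^j)=\#\{x:c_1^ic_2^jx=x\}$ for all integers $i,j$, with $\zeta_1,\zeta_2$ primitive $k_1$-th and $k_2$-th roots of unity. -}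

module Defs where

open import Data.Nat as ℕ using (ℕ; zero; suc; _∸_; _<ᵇ_; _≡ᵇ_)
open import Data.Bool using (Bool; true; false; if_then_else_; _∧_; _∨_; not)
open import Data.Product using (_×_; _,_)
open import Data.Sum using (_⊎_)
open import Data.List using (List; []; _∷_; map; _++_; length; upTo; concatMap; [_])
open import Data.List.Properties using (≡-dec)
open import Data.Integer using (ℤ; +_; -[1+_])
open import Relation.Nullary using (¬_)
open import Relation.Nullary.Decidable using (isYes)
open import Algebra.Bundles using (CommutativeRing)
import Level
import Data.Integer

allB : {A : Set} → (A → Bool) → List A → Bool
allB p [] = true
allB p (x ∷ xs) = p x ∧ allB p xs

count : {A : Set} → (A → Bool) → List A → ℕ
count p [] = 0
count p (x ∷ xs) = if p x then suc (count p xs) else count p xs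

_==L_ : List ℕ → List ℕ → Bool
xs ==L ys = isYes (≡-dec ℕ._≟_ xs ys)

iter : {A : Set} → ℕ → (A → A) → A → A
iter zero f x = x
iter (suc k) f x = f (iter k f x)

insertions : ℕ → List ℕ → List (List ℕ)
insertions x [] = [ x ∷ [] ]
insertions x (y ∷ ys) = (x ∷ y ∷ ys) ∷ map (y ∷_) (insertions x ys)

perms : List ℕ → List (List ℕ)
perms [] = [ [] ]
perms (x ∷ xs) = concatMap (insertions x) (perms xs)

-- Shapes and fillings.  A cell is (row , column), rows numbered from
-- the top, columns from the left (English convention).  A shape is a
-- list of cells; a tableau on a shape is the list of its entries, in
-- the order of the cells of the shape.

Cell : Set
Cell = ℕ × ℕ

_==c_ : Cell → Cell → Bool
(a , b) ==c (c , d) = (a ≡ᵇ c) ∧ (b ≡ᵇ d)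

inShape : List Cell → Cell → Bool
inShape [] c = false
inShape (d ∷ sh) c = (d ==c c) ∨ inShape sh c

Filling : Set
Filling = Cell → ℕ

toFilling : List Cell → List ℕ → Filling
toFilling [] xs c = 0
toFilling (d ∷ sh) [] c = 0
toFilling (d ∷ sh) (x ∷ xs) c = if d ==c c then x else toFilling sh xs c

increasing : List Cell → Filling → Bool
increasing sh f = allB ok sh
  where
  ok : Cell → Bool
  ok (r , c) = (not (inShape sh (r , suc c)) ∨ (f (r , c) <ᵇ f (r , suc c)))
             ∧ (not (inShape sh (suc r , c)) ∨ (f (r , c) <ᵇ f (suc r , c)))

SYTof : List Cell → ℕ → List (List ℕ)
SYTof sh m = filterB (perms (map suc (upTo m)))
  where
  filterB : List (List ℕ) → List (List ℕ)
  filterB [] = []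
  filterB (xs ∷ xss) = if increasing sh (toFilling sh xs)
                        then xs ∷ filterB xss else filterB xss

-- The ribbon shape (1, m-2, 1): top box (row 0) above the last box of the
-- middle row (row 1, columns 0..m-3), bottom box (row 2) below the first.
ribbonShape : ℕ → List Cell
ribbonShape m = (0 , m ∸ 3) ∷ (map (λ j → (1 , j)) (upTo (m ∸ 2)) ++ [ (2 , 0) ])

SYT-R : ℕ → List (List ℕ)
SYT-R m = SYTof (ribbonShape m) m

setF : Filling → Cell → ℕ → Filling
setF f p v q = if q ==c p then v else f q

-- jeu de taquin slide of the dot at p (fuel bounds the number of moves;
-- the path strictly increases row+column, so #cells fuel suffices)
slide : ℕ → List Cell → Filling → Cell → Filling × Cell
slide zero sh f p = f , p
slide (suc n) sh f (r , c) = go (inShape sh (r , suc c)) (inShape sh (suc r , c))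
  where
  right : Filling × Cell
  right = slide n sh (setF f (r , c) (f (r , suc c))) (r , suc c)
  down : Filling × Cell
  down = slide n sh (setF f (r , c) (f (suc r , c))) (suc r , c)
  go : Bool → Bool → Filling × Cell
  go false false = f , (r , c)
  go true false = right
  go false true = down
  go true true = if f (r , suc c) <ᵇ f (suc r , c) then right else down

findCell : List Cell → Filling → ℕ → Cell
findCell [] f v = (0 , 0)
findCell (d ∷ sh) f v = if f d ≡ᵇ v then d else findCell sh f v

promotion : List Cell → ℕ → List ℕ → List ℕ
promotion sh m xs = finish (slide (length sh) sh f (findCell sh f 1))
  where
  f : Filling
  f = toFilling sh xs
  finish : Filling × Cell → List ℕ
  finish (g , q) = map (λ c → if c ==c q then m else g c ∸ 1) sh

promo : ℕ → List ℕ → List ℕ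
promo m = promotion (ribbonShape m) m

hasPeriod : ℕ → ℕ → List ℕ → Bool
hasPeriod m d T = (0 <ᵇ d) ∧ (iter d (promo m) T ==L T)
                ∧ allB (λ k → not (iter k (promo m) T ==L T)) (map suc (upTo (d ∸ 1)))

-- #{T : ∂^k T = T}; for an integer k we use |k|, since ∂ is a bijection
-- and ∂^{-n} T = T iff ∂^n T = T.
fixCount : ℕ → ℤ → ℕ
fixCount m k = count (λ T → iter (Data.Integer.∣ k ∣) (promo m) T ==L T) (SYT-R m)

module RingDefs {c ℓ} (R : CommutativeRing c ℓ) where
  open CommutativeRing R

  pow : Carrier → ℕ → Carrier
  pow x zero = 1#
  pow x (suc n) = x * pow x n

  -- integer power of a unit x with inverse xi
  zpow : Carrier → Carrier → ℤ → Carrier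
  zpow x xi (+ n) = pow x n
  zpow x xi -[1+ n ] = pow xi (suc n)

  qint : ℕ → Carrier → Carrier
  qint zero q = 0#
  qint (suc r) q = qint r q + pow q r

  natC : ℕ → Carrier
  natC zero = 0#
  natC (suc n) = 1# + natC n

  IsPrimitiveRoot : ℕ → Carrier → Set ℓ
  IsPrimitiveRoot n x = (pow x n ≈ 1#) × (∀ k → 0 ℕ.< k → k ℕ.< n → ¬ (pow x k ≈ 1#))

  NoZeroDivisors : Set (c Level.⊔ ℓ)
  NoZeroDivisors = ∀ x y → x * y ≈ 0# → (x ≈ 0#) ⊎ (y ≈ 0#)

  ψ : ℕ → Carrier → Carrier → Carrier
  ψ m q t = qint (m ∸ 2) t + natC (m ∸ 3) * qint (m ∸ 1) q

-- A ribbon tableau is determined by its top entry a and its bottom entry c, the middle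
-- row being the remaining entries in increasing order.  In these coordinates promotion is
--   (a , c) ↦ (a-1 , c-1),   with a = 0 read as m-1 and c = 1 read as m,
-- except that (2 , 3) ↦ (1 , m) and (1 , m) ↦ (m-2 , m-1).  Every orbit contains exactly one
-- tableau with a = 1, and these are the (1 , c) with 3 ≤ c ≤ m.  The orbit of (1 , m) consists
-- of (1 , m) and the (j , j+1) with 2 ≤ j ≤ m-2; for c < m the coordinate a runs once through
-- 1, …, m-1.  A power of promotion fixes a tableau iff its exponent is divisible by the orbit
-- size, and the sieving identity follows because [n]_x is n or 0 for an n-th root of unity x,
-- according to whether x = 1.

module Submission where

open import Defs
open import Algebra.Bundles using (CommutativeRing)
open import Data.Bool using (Bool; true; false; T; T?; not; _∧_; _∨_; if_then_else_)
open import Data.Integer as ℤ using (ℤ; +_; -[1+_])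
open import Data.Nat as ℕ using (ℕ; zero; suc; NonZero; z<s)
open import Data.Nat.DivMod using (_/_; _%_; m≡m%n+[m/n]*n; m%n<n)
open import Data.Nat.Divisibility using (_∣_; _∣?_; divides; m%n≡0⇒n∣m; ∣⇒≤; ∣-refl; ∣m+n∣m⇒∣n; ∣1⇒≡1; n∣m*n; m∣m*n; *-monoˡ-∣)
import Data.Nat.Properties as ℕ
open import Data.Product using (_×_; _,_; ∃; ∃₂; proj₁; proj₂)
open import Data.Sum as Sum using (_⊎_; inj₁; inj₂)
open import Relation.Binary.PropositionalEquality as ≡ using (_≡_; _≢_)
open import Relation.Nullary using (Dec; ¬_; yes; no; does; contradiction)

-- The tableaux come as a filtered list of permutations, while the orbits live on coordinates. The
-- bridge is an enumeration of the orbits from their base points: it is duplicate-free and has the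
-- same members as the list of tableaux, so the two lists are permutations of each other and every
-- count can be made orbit by orbit. The delicate point is a single promotion step. The path of the
-- dot depends on where 1 lies and, if 1 opens the middle row, on whether the second middle entry is
-- below the bottom entry. Middle entries are not coordinates, but they can be recovered, because
-- every value other than a and c lies in the middle row. The exceptional pairs arise when the
-- expected values are taken: for (2 , 3) both 2 and 3 are missing from the row, so the dot goes
-- down; for (1 , m) the value m is missing, so it is m-1 that rises into the top box. The two orbit
-- sizes are consecutive, hence coprime, which makes the order their product.

module RootsOfUnity {c ℓ} (R : CommutativeRing c ℓ) where
  open CommutativeRing R
  open RingDefs R
  open import Algebra.Properties.Ring ring using (+-cancelʳ; x≈y⇒x∙y⁻¹≈ε; x∙y⁻¹≈ε⇒x≈y; [y-z]x≈yx-zx)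
  open import Algebra.Properties.CommutativeSemiring.Exp commutativeSemiring using (_^_; ^-congˡ; ^-homo-*; ^-assocʳ; ^-distrib-*)
  open import Algebra.Properties.Semiring.Mult semiring using (×-homo-+; ×1-homo-*) renaming (_×_ to _·_)
  open import Relation.Binary.Reasoning.Setoid setoid

  pow-^ : ∀ x n → pow x n ≡ x ^ n
  pow-^ x zero    = ≡.refl
  pow-^ x (suc n) = ≡.cong (x *_) (pow-^ x n)

  natC-× : ∀ n → natC n ≡ n · 1#
  natC-× zero    = ≡.refl
  natC-× (suc n) = ≡.cong (λ y → 1# + y) (natC-× n)

  pow-cong : ∀ {x y} n → x ≈ y → pow x n ≈ pow y n
  pow-cong {x} {y} n x≈y rewrite pow-^ x n | pow-^ y n = ^-congˡ n x≈y

  pow-+ : ∀ x m n → pow x (m ℕ.+ n) ≈ pow x m * pow x n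
  pow-+ x m n rewrite pow-^ x (m ℕ.+ n) | pow-^ x m | pow-^ x n = ^-homo-* x m n

  pow-pow : ∀ x m n → pow (pow x m) n ≈ pow x (m ℕ.* n)
  pow-pow x m n rewrite pow-^ (pow x m) n | pow-^ x m | pow-^ x (m ℕ.* n) = ^-assocʳ x m n

  pow-distrib : ∀ x y n → pow (x * y) n ≈ pow x n * pow y n
  pow-distrib x y n rewrite pow-^ (x * y) n | pow-^ x n | pow-^ y n = ^-distrib-* x y n

  pow-1# : ∀ n → pow 1# n ≈ 1#
  pow-1# zero    = refl
  pow-1# (suc n) = trans (*-identityˡ _) (pow-1# n)

  natC-+ : ∀ m n → natC (m ℕ.+ n) ≈ natC m + natC n
  natC-+ m n rewrite natC-× (m ℕ.+ n) | natC-× m | natC-× n = ×-homo-+ 1# m n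

  natC-* : ∀ m n → natC (m ℕ.* n) ≈ natC m * natC n
  natC-* m n rewrite natC-× (m ℕ.* n) | natC-× m | natC-× n = ×1-homo-* m n

  pow-multiple : ∀ {x n} → pow x n ≈ 1# → ∀ q → pow x (q ℕ.* n) ≈ 1#
  pow-multiple {x} {n} xⁿ≈1 q = begin
    pow x (q ℕ.* n)   ≡⟨ ≡.cong (pow x) (ℕ.*-comm q n) ⟩
    pow x (n ℕ.* q)   ≈⟨ pow-pow x n q ⟨
    pow (pow x n) q   ≈⟨ pow-cong q xⁿ≈1 ⟩
    pow 1# q          ≈⟨ pow-1# q ⟩
    1#                ∎

  pow-% : ∀ {x n} .{{_ : NonZero n}} → pow x n ≈ 1# → ∀ l → pow x l ≈ pow x (l % n)
  pow-% {x} {n} xⁿ≈1 l = begin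
    pow x l                                   ≡⟨ ≡.cong (pow x) (m≡m%n+[m/n]*n l n) ⟩
    pow x (l % n ℕ.+ l / n ℕ.* n)             ≈⟨ pow-+ x (l % n) (l / n ℕ.* n) ⟩
    pow x (l % n) * pow x (l / n ℕ.* n)       ≈⟨ *-congˡ (pow-multiple xⁿ≈1 (l / n)) ⟩
    pow x (l % n) * 1#                        ≈⟨ *-identityʳ _ ⟩
    pow x (l % n)                             ∎

  primitive⇒∣ : ∀ {x n} .{{_ : NonZero n}} → IsPrimitiveRoot n x → ∀ l → pow x l ≈ 1# → n ∣ l
  primitive⇒∣ {x} {n} (xⁿ≈1 , minimal) l xˡ≈1 with l % n in eq | m%n<n l n | trans (sym (pow-% xⁿ≈1 l)) xˡ≈1
  ... | zero  | _   | _    = m%n≡0⇒n∣m l n eq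
  ... | suc r | r<n | xʳ≈1 = contradiction xʳ≈1 (minimal (suc r) z<s r<n)

  inverse-root : ∀ {x x⁻¹} l → x * x⁻¹ ≈ 1# → pow x l ≈ 1# → pow x⁻¹ l ≈ 1#
  inverse-root {x} {x⁻¹} l inv xˡ≈1 = begin
    pow x⁻¹ l             ≈⟨ *-identityˡ _ ⟨
    1# * pow x⁻¹ l        ≈⟨ *-congʳ xˡ≈1 ⟨
    pow x l * pow x⁻¹ l   ≈⟨ pow-distrib x x⁻¹ l ⟨
    pow (x * x⁻¹) l       ≈⟨ pow-cong l inv ⟩
    pow 1# l              ≈⟨ pow-1# l ⟩
    1#                    ∎

  zpow≈1⇒pow≈1 : ∀ {x x⁻¹} → x * x⁻¹ ≈ 1# → ∀ r → zpow x x⁻¹ r ≈ 1# → pow x ℤ.∣ r ∣ ≈ 1#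
  zpow≈1⇒pow≈1 inv (+ n)    h = h
  zpow≈1⇒pow≈1 inv -[1+ n ] h = inverse-root (suc n) (trans (*-comm _ _) inv) h

  pow≈1⇒zpow≈1 : ∀ {x x⁻¹} → x * x⁻¹ ≈ 1# → ∀ r → pow x ℤ.∣ r ∣ ≈ 1# → zpow x x⁻¹ r ≈ 1#
  pow≈1⇒zpow≈1 inv (+ n)    h = h
  pow≈1⇒zpow≈1 inv -[1+ n ] h = inverse-root (suc n) inv h

  pow-root : ∀ {x} n l → pow x n ≈ 1# → pow (pow x l) n ≈ 1#
  pow-root {x} n l xⁿ≈1 = trans (pow-pow x l n) (pow-multiple xⁿ≈1 l)

  zpow-root : ∀ {x x⁻¹} n → x * x⁻¹ ≈ 1# → pow x n ≈ 1# → ∀ r → pow (zpow x x⁻¹ r) n ≈ 1#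
  zpow-root n inv xⁿ≈1 (+ l)    = pow-root n l xⁿ≈1
  zpow-root n inv xⁿ≈1 -[1+ l ] = pow-root n (suc l) (inverse-root n inv xⁿ≈1)

  qint-one : ∀ {x} n → x ≈ 1# → qint n x ≈ natC n
  qint-one zero        x≈1 = refl
  qint-one {x} (suc n) x≈1 = begin
    qint n x + pow x n   ≈⟨ +-cong (qint-one n x≈1) (trans (pow-cong n x≈1) (pow-1# n)) ⟩
    natC n + 1#          ≈⟨ +-comm _ _ ⟩
    1# + natC n          ∎

  -- The geometric sum formula with both sides moved so that no subtraction occurs.
  qint-geometric : ∀ x n → x * qint n x + 1# ≈ qint n x + pow x n
  qint-geometric x zero    = +-congʳ (zeroʳ x)
  qint-geometric x (suc n) = begin
    x * (qint n x + pow x n) + 1#         ≈⟨ +-congʳ (distribˡ x _ _) ⟩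
    (x * qint n x + x * pow x n) + 1#     ≈⟨ +-assoc _ _ _ ⟩
    x * qint n x + (x * pow x n + 1#)     ≈⟨ +-congˡ (+-comm _ _) ⟩
    x * qint n x + (1# + x * pow x n)     ≈⟨ +-assoc _ _ _ ⟨
    (x * qint n x + 1#) + x * pow x n     ≈⟨ +-congʳ (qint-geometric x n) ⟩
    qint n x + pow x n + x * pow x n      ∎

  -- The product of x - 1 and [n]_x is x^n - 1 = 0, and the first factor is nonzero.
  qint-zero : NoZeroDivisors → ∀ {x} n → pow x n ≈ 1# → ¬ (x ≈ 1#) → qint n x ≈ 0#
  qint-zero noZeroDivisors {x} n xⁿ≈1 x≉1 with noZeroDivisors (x - 1#) (qint n x) product≈0
    where
    xq≈q : x * qint n x ≈ qint n x
    xq≈q = +-cancelʳ 1# _ _ (trans (qint-geometric x n) (+-congˡ xⁿ≈1))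
    product≈0 : (x - 1#) * qint n x ≈ 0#
    product≈0 = trans ([y-z]x≈yx-zx _ _ _) (x≈y⇒x∙y⁻¹≈ε (trans xq≈q (sym (*-identityˡ _))))
  ... | inj₁ x-1≈0 = contradiction (x∙y⁻¹≈ε⇒x≈y _ _ x-1≈0) x≉1
  ... | inj₂ q≈0   = q≈0

  -- By primitivity the power is 1 exactly when n divides the exponent. The sign of r does not
  -- matter, since `x` and its inverse have trivial powers at the same exponents.
  qint-zpow : NoZeroDivisors → ∀ {x x⁻¹ n} .{{_ : NonZero n}} → IsPrimitiveRoot n x → x * x⁻¹ ≈ 1# →
              ∀ r → qint n (zpow x x⁻¹ r) ≈ natC (if does (n ∣? ℤ.∣ r ∣) then n else 0)
  qint-zpow nzd {x} {x⁻¹} {n} prim inv r with n ∣? ℤ.∣ r ∣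
  ... | yes (divides q eq) = qint-one n (pow≈1⇒zpow≈1 inv r
          (trans (reflexive (≡.cong (pow x) eq)) (pow-multiple (proj₁ prim) q)))
  ... | no n∤r = qint-zero nzd n (zpow-root n inv (proj₁ prim) r)
          λ h → n∤r (primitive⇒∣ prim ℤ.∣ r ∣ (zpow≈1⇒pow≈1 inv r h))

open import Data.Bool.Properties using (T-≡; ∨-zeroʳ)
open import Data.Empty using (⊥-elim)
import Data.Integer.Divisibility.Signed as ℤ∣
import Data.Integer.Properties as ℤ
import Data.Integer.Tactic.RingSolver as ℤSolver
open import Data.List using (List; []; _∷_; [_]; _∷ʳ_; _++_; map; filter; length; upTo; applyUpTo; concatMap)
open import Data.List.Membership.Propositional using (_∈_; _∉_; find; lose)
open import Data.List.Membership.Propositional.Properties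
open import Data.List.Membership.Propositional.Properties.WithK using (unique∧set⇒bag)
open import Data.List.Properties
  using (≡-dec; ∷-injectiveˡ; ∷-injectiveʳ; ∷ʳ-injectiveʳ; length-applyUpTo; length-map; length-++;
         map-++; map-∘; map-id; map-applyUpTo; map-upTo; ++-assoc; applyUpTo-∷ʳ)
open import Data.List.Relation.Binary.BagAndSetEquality using (∼bag⇒↭)
open import Data.List.Relation.Binary.Permutation.Propositional as ↭
  using (_↭_; ↭-refl; ↭-sym; ↭-trans; ↭-prep; ↭-swap; ↭-reflexive; ↭⇒↭ₛ)
open import Data.List.Relation.Binary.Permutation.Propositional.Properties as ↭ₚ
  using (∈-resp-↭; shift; drop-∷; drop-mid; ↭-empty-inv; ↭-length; ∷↭∷ʳ; ++⁺ʳ)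
import Data.List.Relation.Binary.Permutation.Setoid.Properties as ↭ₛ
open import Data.List.Relation.Binary.Pointwise using (Pointwise-≡⇒≡)
open import Data.List.Relation.Unary.All as All using ([]; _∷_)
open import Data.List.Relation.Unary.AllPairs using ([]; _∷_)
open import Data.List.Relation.Unary.Any using (here; there)
open import Data.List.Relation.Unary.Sorted.TotalOrder.Properties using (↗↭↗⇒≋; applyUpTo⁺₁)
open import Data.List.Relation.Unary.Unique.Propositional using (Unique)
import Data.List.Relation.Unary.Unique.Propositional.Properties as Unique
open import Data.Nat using (pred; _+_; _∸_; _*_; _≤_; _<_; _<ᵇ_; z≤n; s≤s; s<s; s≤s⁻¹; >-nonZero; >-nonZero⁻¹)
open import Data.Nat.Coprimality using (Coprime; coprime-divisor)
open import Data.Nat.Properties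
open import Data.Nat.Tactic.RingSolver using (solve-∀)
open import Function using (_∘_; Equivalence; mk⇔; _⇔_)
open import Level using (Level; _⊔_)
open import Relation.Binary.Definitions using (tri<; tri≈; tri>)
open import Relation.Binary.PropositionalEquality using (refl; sym; trans; cong; cong₂; subst; subst₂; setoid; module ≡-Reasoning)
open import Relation.Nullary.Decidable using (dec-true; dec-false; does-⇔)

-- Boolean tests as propositions

T⁻ : ∀ {b} → T b → b ≡ true
T⁻ = Equivalence.to T-≡

T⁺ : ∀ {b} → b ≡ true → T b
T⁺ = Equivalence.from T-≡

not-true : ∀ {b} → ¬ b ≡ true → b ≡ false
not-true {false} _ = refl
not-true {true}  h = ⊥-elim (h refl)

∧-true⁻ : ∀ {a b} → a ∧ b ≡ true → a ≡ true × b ≡ true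
∧-true⁻ {true} {true} refl = refl , refl

∧-true⁺ : ∀ {a b} → a ≡ true → b ≡ true → a ∧ b ≡ true
∧-true⁺ refl refl = refl

⇒-true⁻ : ∀ {a b} → not a ∨ b ≡ true → a ≡ true → b ≡ true
⇒-true⁻ h refl = h

⇒-true⁺ : ∀ {a b} → (a ≡ true → b ≡ true) → not a ∨ b ≡ true
⇒-true⁺ {false} h = refl
⇒-true⁺ {true}  h = h refl

allB⁻ : ∀ {A : Set} (p : A → Bool) xs → allB p xs ≡ true → ∀ {x} → x ∈ xs → p x ≡ true
allB⁻ p (x ∷ xs) h (here refl) = proj₁ (∧-true⁻ h)
allB⁻ p (x ∷ xs) h (there i)   = allB⁻ p xs (proj₂ (∧-true⁻ {p x} h)) i

allB⁺ : ∀ {A : Set} (p : A → Bool) xs → (∀ {x} → x ∈ xs → p x ≡ true) → allB p xs ≡ true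
allB⁺ p []       h = refl
allB⁺ p (x ∷ xs) h = ∧-true⁺ (h (here refl)) (allB⁺ p xs (h ∘ there))

-- Permutations

insertions-↭ : ∀ x ys {zs} → zs ∈ insertions x ys → zs ↭ x ∷ ys
insertions-↭ x []       (here refl) = ↭-refl
insertions-↭ x (y ∷ ys) (here refl) = ↭-refl
insertions-↭ x (y ∷ ys) (there i) with ∈-map⁻ (y ∷_) i
... | zs , zs∈ , refl = ↭-trans (↭-prep y (insertions-↭ x ys zs∈)) (↭-swap y x ↭-refl)

perms-↭ : ∀ xs {ys} → ys ∈ perms xs → ys ↭ xs
perms-↭ []       (here refl) = ↭-refl
perms-↭ (x ∷ xs) i with find (∈-concatMap⁻ (insertions x) {xs = perms xs} i)
... | zs , zs∈ , ys∈ = ↭-trans (insertions-↭ x zs ys∈) (↭-prep x (perms-↭ xs zs∈))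

insertions-∈ : ∀ x ys zs → ys ++ x ∷ zs ∈ insertions x (ys ++ zs)
insertions-∈ x []       []       = here refl
insertions-∈ x []       (z ∷ zs) = here refl
insertions-∈ x (y ∷ ys) zs       = there (∈-map⁺ (y ∷_) (insertions-∈ x ys zs))

↭-perms : ∀ xs {ys} → ys ↭ xs → ys ∈ perms xs
↭-perms []       p rewrite ↭-empty-inv p = here refl
↭-perms (x ∷ xs) p with ∈-∃++ (∈-resp-↭ (↭-sym p) (here refl))
... | as , bs , refl =
  ∈-concatMap⁺ (insertions x) (lose (↭-perms xs (drop-mid as [] p)) (insertions-∈ x as bs))

Unique-insertions : ∀ x ys → x ∉ ys → Unique (insertions x ys)
Unique-insertions x []       _   = [] ∷ []
Unique-insertions x (y ∷ ys) x∉ =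
  All.tabulate (λ i → λ { refl → case (∈-map⁻ (y ∷_) i) })
  ∷ Unique.map⁺ ∷-injectiveʳ (Unique-insertions x ys (x∉ ∘ there))
  where
  case : ¬ ∃ λ zs → zs ∈ insertions x ys × x ∷ y ∷ ys ≡ y ∷ zs
  case (_ , _ , refl) = x∉ (here refl)

-- Deleting `x` from `ws` recovers both lists, because `x` occurs in neither of them.
insertions-disjoint : ∀ x ys zs {ws} → x ∉ ys → x ∉ zs →
                      ws ∈ insertions x ys → ws ∈ insertions x zs → ys ≡ zs
insertions-disjoint x []       []       x∉ x∉′ i j = refl
insertions-disjoint x []       (z ∷ zs) x∉ x∉′ (here refl) (there j)
  with ∈-map⁻ (z ∷_) j
... | _ , _ , refl = ⊥-elim (x∉′ (here refl))
insertions-disjoint x (y ∷ ys) []       x∉ x∉′ (there i) (here refl)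
  with ∈-map⁻ (y ∷_) i
... | _ , _ , refl = ⊥-elim (x∉ (here refl))
insertions-disjoint x (y ∷ ys) (z ∷ zs) x∉ x∉′ (here refl) (here refl) = refl
insertions-disjoint x (y ∷ ys) (z ∷ zs) x∉ x∉′ (here refl) (there j)
  with ∈-map⁻ (z ∷_) j
... | _ , _ , refl = ⊥-elim (x∉′ (here refl))
insertions-disjoint x (y ∷ ys) (z ∷ zs) x∉ x∉′ (there i) (here refl)
  with ∈-map⁻ (y ∷_) i
... | _ , _ , refl = ⊥-elim (x∉ (here refl))
insertions-disjoint x (y ∷ ys) (z ∷ zs) x∉ x∉′ (there i) (there j)
  with ∈-map⁻ (y ∷_) i | ∈-map⁻ (z ∷_) j
... | _ , i′ , refl | _ , j′ , refl =
  cong (y ∷_) (insertions-disjoint x ys zs (x∉ ∘ there) (x∉′ ∘ there) i′ j′)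

Unique-concatMap : ∀ {A B : Set} (f : A → List B) xs → Unique xs →
                   (∀ {x} → x ∈ xs → Unique (f x)) →
                   (∀ {x y z} → x ∈ xs → y ∈ xs → z ∈ f x → z ∈ f y → x ≡ y) →
                   Unique (concatMap f xs)
Unique-concatMap f []       _          _  _ = []
Unique-concatMap f (x ∷ xs) (x∉ ∷ xs!) f! d =
  Unique.++⁺ (f! (here refl))
    (Unique-concatMap f xs xs! (f! ∘ there) (λ i j → d (there i) (there j)))
    λ { (i , j) → let y , y∈ , j′ = find (∈-concatMap⁻ f {xs = xs} j)
                  in All.lookup x∉ y∈ (d (here refl) (there y∈) i j′) }

Unique-perms : ∀ xs → Unique xs → Unique (perms xs)
Unique-perms []       _          = [] ∷ []
Unique-perms (x ∷ xs) (x∉ ∷ xs!) =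
  Unique-concatMap (insertions x) (perms xs) (Unique-perms xs xs!)
    (λ {ys} i → Unique-insertions x ys (avoid i))
    (λ {ys} {zs} i j → insertions-disjoint x ys zs (avoid i) (avoid j))
  where
  avoid : ∀ {ys} → ys ∈ perms xs → x ∉ ys
  avoid i x∈ = All.lookup x∉ (∈-resp-↭ (perms-↭ xs i) x∈) refl

-- Standard tableaux on an arbitrary shape

isTableau? : ∀ sh (xs : List ℕ) → Dec (T (increasing sh (toFilling sh xs)))
isTableau? sh xs = T? (increasing sh (toFilling sh xs))

-- The local function of SYTof cannot be named, so the type of the auxiliary
-- lemma is left to unification.
mutual
  SYTof-filter : ∀ sh m → SYTof sh m ≡ filter (isTableau? sh) (perms (map suc (upTo m)))
  SYTof-filter sh m with perms (map suc (upTo m))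
  ... | xss = filterB-filter sh m xss

  filterB-filter : ∀ sh (m : ℕ) (xss : List (List ℕ)) → _
  filterB-filter sh m []         = refl
  filterB-filter sh m (xs ∷ xss) with increasing sh (toFilling sh xs)
  ... | true  = cong (xs ∷_) (filterB-filter sh m xss)
  ... | false = filterB-filter sh m xss

==c⇒≡ : ∀ {d e} → (d ==c e) ≡ true → d ≡ e
==c⇒≡ {a , b} {c , d} h with ∧-true⁻ h
... | p , q = cong₂ _,_ (≡ᵇ⇒≡ a c (T⁺ p)) (≡ᵇ⇒≡ b d (T⁺ q))

==c-refl : ∀ d → (d ==c d) ≡ true
==c-refl (a , b) = ∧-true⁺ (T⁻ (≡⇒≡ᵇ a a refl)) (T⁻ (≡⇒≡ᵇ b b refl))

==c-≢ : ∀ {d e} → d ≢ e → (d ==c e) ≡ false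
==c-≢ d≢e = not-true (d≢e ∘ ==c⇒≡)

if-== : ∀ d {x y : ℕ} → (if d ==c d then x else y) ≡ x
if-== d rewrite ==c-refl d = refl

if-≢ : ∀ d e {x y : ℕ} → d ≢ e → (if d ==c e then x else y) ≡ y
if-≢ d e d≢e rewrite ==c-≢ d≢e = refl

inShape-∈ : ∀ sh {c} → inShape sh c ≡ true → c ∈ sh
inShape-∈ (d ∷ sh) {c} h with d ==c c in eq
... | true  = here (sym (==c⇒≡ eq))
... | false = there (inShape-∈ sh h)

∈-inShape : ∀ {sh c} → c ∈ sh → inShape sh c ≡ true
∈-inShape {d ∷ sh} (here refl) rewrite ==c-refl d = refl
∈-inShape {d ∷ sh} {c} (there i) rewrite ∈-inShape i = ∨-zeroʳ (d ==c c)

∉-inShape : ∀ {sh c} → c ∉ sh → inShape sh c ≡ false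
∉-inShape {sh} c∉ = not-true (c∉ ∘ inShape-∈ sh)

toFilling-map : ∀ (F : Filling) sh {d} → d ∈ sh → toFilling sh (map F sh) d ≡ F d
toFilling-map F (e ∷ sh) (here refl) rewrite ==c-refl e = refl
toFilling-map F (e ∷ sh) {d} (there i) with e ==c d in eq
... | true  = cong F (==c⇒≡ eq)
... | false = toFilling-map F sh i

setF-≡ : ∀ f p v → setF f p v p ≡ v
setF-≡ f p v = if-== p

setF-≢ : ∀ f {p q} v → q ≢ p → setF f p v q ≡ f q
setF-≢ f {p} {q} v = if-≢ q p

-- `findCell` returns the first match. Asking that the match be unique spares any reasoning about
-- the order of the cells.
findCell-first : ∀ sh (f : Filling) {v d} → d ∈ sh → f d ≡ v →
                 (∀ {e} → e ∈ sh → f e ≡ v → e ≡ d) → findCell sh f v ≡ d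
findCell-first (e ∷ sh) f {v} i fd only with f e Data.Nat.≡ᵇ v in eq
... | true = only (here refl) (≡ᵇ⇒≡ _ _ (T⁺ eq))
findCell-first (e ∷ sh) f {v} (here refl) fd only | false
  = contradiction (trans (sym (T⁻ (≡⇒≡ᵇ _ _ fd))) eq) λ ()
findCell-first (e ∷ sh) f (there i) fd only | false = findCell-first sh f i fd (only ∘ there)

Increasing : List Cell → Filling → Set
Increasing sh f = ∀ {r c} → (r , c) ∈ sh →
  ((r , suc c) ∈ sh → f (r , c) < f (r , suc c)) ×
  ((suc r , c) ∈ sh → f (r , c) < f (suc r , c))

increasing⁻ : ∀ sh f → increasing sh f ≡ true → Increasing sh f
increasing⁻ sh f h i with ∧-true⁻ (allB⁻ _ sh h i)
... | p , q = (λ j → <ᵇ⇒< _ _ (T⁺ (⇒-true⁻ p (∈-inShape j))))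
            , (λ j → <ᵇ⇒< _ _ (T⁺ (⇒-true⁻ q (∈-inShape j))))

increasing⁺ : ∀ sh f → Increasing sh f → increasing sh f ≡ true
increasing⁺ sh f h = allB⁺ _ sh λ i →
  ∧-true⁺ (⇒-true⁺ (λ e → T⁻ (<⇒<ᵇ (proj₁ (h i) (inShape-∈ sh e)))))
          (⇒-true⁺ (λ e → T⁻ (<⇒<ᵇ (proj₂ (h i) (inShape-∈ sh e)))))

-- Ribbon tableaux

-- The ribbon with k + 4 boxes has k + 2 boxes in its middle row.
ribbon : ℕ → List Cell
ribbon k = ribbonShape (4 + k)

top∈ : ∀ k → (0 , suc k) ∈ ribbon k
top∈ k = here refl

mid∈ : ∀ {k j} → j < 2 + k → (1 , j) ∈ ribbon k
mid∈ j< = there (∈-++⁺ˡ (∈-map⁺ (1 ,_) (∈-upTo⁺ j<)))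

bot∈ : ∀ k → (2 , 0) ∈ ribbon k
bot∈ k = there (∈-++⁺ʳ (map (1 ,_) (upTo (2 + k))) (here refl))

data RibbonCell (k : ℕ) : Cell → Set where
  top : RibbonCell k (0 , suc k)
  mid : ∀ {j} → j < 2 + k → RibbonCell k (1 , j)
  bot : RibbonCell k (2 , 0)

∈-ribbon : ∀ {k d} → d ∈ ribbon k → RibbonCell k d
∈-ribbon (here refl) = top
∈-ribbon {k} (there i) with ∈-++⁻ (map (1 ,_) (upTo (2 + k))) i
... | inj₂ (here refl) = bot
... | inj₁ j with ∈-map⁻ (1 ,_) j
... | _ , l , refl = mid (∈-upTo⁻ l)

ribbon-∈ : ∀ {k d} → RibbonCell k d → d ∈ ribbon k
ribbon-∈ {k} top      = top∈ k
ribbon-∈ (mid j<)     = mid∈ j<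
ribbon-∈ {k} bot      = bot∈ k

-- The middle row is a function on all naturals, so that it can be shifted and compared without
-- index proofs; only its first n values matter.
rows : ℕ → ℕ → (ℕ → ℕ) → ℕ → List ℕ
rows n a β c = a ∷ applyUpTo β n ++ [ c ]

-- The column is ignored in the outer rows: each has a single box, and values off the shape are
-- irrelevant.
rowFilling : ℕ → (ℕ → ℕ) → ℕ → Filling
rowFilling a β c (0 , _)           = a
rowFilling a β c (1 , j)           = β j
rowFilling a β c (suc (suc _) , _) = c

map-ribbon : ∀ k (F : Filling) →
             map F (ribbon k) ≡ rows (2 + k) (F (0 , suc k)) (λ j → F (1 , j)) (F (2 , 0))
map-ribbon k F = cong (F (0 , suc k) ∷_) (trans
  (map-++ F (map (1 ,_) (upTo (2 + k))) [ (2 , 0) ])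
  (cong (_++ [ F (2 , 0) ]) (trans (sym (map-∘ (upTo (2 + k)))) (map-upTo _ (2 + k)))))

applyUpTo-cong : ∀ {A : Set} {f g : ℕ → A} n → (∀ {i} → i < n → f i ≡ g i) → applyUpTo f n ≡ applyUpTo g n
applyUpTo-cong zero    h = refl
applyUpTo-cong (suc n) h = cong₂ _∷_ (h z<s) (applyUpTo-cong n (h ∘ s<s))

list-applyUpTo : ∀ n (xs : List ℕ) → length xs ≡ suc n → ∃₂ λ β c → xs ≡ applyUpTo β n ++ [ c ]
list-applyUpTo zero    (x ∷ []) _ = (λ _ → 0) , x , refl
list-applyUpTo (suc n) (x ∷ xs) e with list-applyUpTo n xs (suc-injective e)
... | β , c , refl = (λ { zero → x ; (suc j) → β j }) , c , refl

list-rows : ∀ n xs → length xs ≡ 2 + n → ∃₂ λ a β → ∃ λ c → xs ≡ rows n a β c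
list-rows n (x ∷ xs) e with list-applyUpTo n xs (suc-injective e)
... | β , c , refl = x , β , c , refl

entries : ℕ → List ℕ
entries k = map suc (upTo (4 + k))

-- The coordinates `a` and `c` are indices, so that the action of promotion can be stated as a
-- change of type. `standard` is kept as a permutation because both membership in `SYT-R` and
-- distinctness of entries follow from it.
record Tableau (k a c : ℕ) (xs : List ℕ) : Set where
  constructor tableau
  field
    row         : ℕ → ℕ
    list        : xs ≡ rows (2 + k) a row c
    standard    : xs ↭ entries k
    row-step    : ∀ {j} → suc j < 2 + k → row j < row (suc j)
    top<last    : a < row (suc k)
    first<bot   : row 0 < c

rows-filling : ∀ k a β c {d} → RibbonCell k d →
               toFilling (ribbon k) (rows (2 + k) a β c) d ≡ rowFilling a β c d
rows-filling k a β c {d} i =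
  trans (cong (λ xs → toFilling (ribbon k) xs d) (sym (map-ribbon k (rowFilling a β c))))
        (toFilling-map (rowFilling a β c) (ribbon k) (ribbon-∈ i))

∈-SYT⇒Tableau : ∀ {k xs} → xs ∈ SYT-R (4 + k) → ∃₂ λ a c → Tableau k a c xs
∈-SYT⇒Tableau {k} {xs} i
  with ∈-filter⁻ (isTableau? (ribbon k)) {xs = perms (entries k)} (subst (xs ∈_) (SYTof-filter (ribbon k) (4 + k)) i)
... | p , inc
  with perms-↭ (entries k) p
... | std
  with list-rows (2 + k) xs (trans (↭-length std) (trans (length-map suc (upTo (4 + k))) (length-applyUpTo (λ j → j) (4 + k))))
... | a , β , c , refl
  with increasing⁻ (ribbon k) (toFilling (ribbon k) xs) (T⁻ inc)
... | incr = a , c , tableau β refl std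
    (λ {j} h → subst₂ _<_ (at (mid (<-trans (n<1+n j) h))) (at (mid h))
                 (proj₁ (incr (mid∈ (<-trans (n<1+n j) h))) (mid∈ h)))
    (subst₂ _<_ (at top) (at (mid (n<1+n (suc k)))) (proj₂ (incr (top∈ k)) (mid∈ (n<1+n (suc k)))))
    (subst₂ _<_ (at (mid z<s)) (at bot) (proj₂ (incr (mid∈ z<s)) (bot∈ k)))
  where
  at : ∀ {d} → RibbonCell k d → toFilling (ribbon k) (rows (2 + k) a β c) d ≡ rowFilling a β c d
  at = rows-filling k a β c

Tableau⇒∈-SYT : ∀ {k a c xs} → Tableau k a c xs → xs ∈ SYT-R (4 + k)
Tableau⇒∈-SYT {k} {a} {c} {xs} (tableau β refl std mono a< <c) =
  subst (xs ∈_) (sym (SYTof-filter (ribbon k) (4 + k)))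
    (∈-filter⁺ (isTableau? (ribbon k)) (↭-perms (entries k) std)
      (T⁺ (increasing⁺ (ribbon k) _ λ i → incr (∈-ribbon i))))
  where
  at : ∀ {d} → RibbonCell k d → rowFilling a β c d ≡ toFilling (ribbon k) (rows (2 + k) a β c) d
  at = sym ∘ rows-filling k a β c
  f : Filling
  f = toFilling (ribbon k) (rows (2 + k) a β c)
  -- In `right` and `down` all other pairs of boxes are ruled out by their coordinates: the ribbon
  -- has no further adjacent boxes.
  right : ∀ {r i} → RibbonCell k (r , i) → RibbonCell k (r , suc i) → rowFilling a β c (r , i) < rowFilling a β c (r , suc i)
  right (mid _) (mid h) = mono h
  down : ∀ {r i} → RibbonCell k (r , i) → RibbonCell k (suc r , i) → rowFilling a β c (r , i) < rowFilling a β c (suc r , i)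
  down top (mid _) = a<
  down (mid _) bot = <c
  incr : ∀ {r i} → RibbonCell k (r , i) →
         ((r , suc i) ∈ ribbon k → f (r , i) < f (r , suc i)) ×
         ((suc r , i) ∈ ribbon k → f (r , i) < f (suc r , i))
  incr i = (λ j → subst₂ _<_ (at i) (at (∈-ribbon j)) (right i (∈-ribbon j)))
         , (λ j → subst₂ _<_ (at i) (at (∈-ribbon j)) (down i (∈-ribbon j)))

Unique-entries : ∀ k → Unique (entries k)
Unique-entries k = Unique.map⁺ suc-injective (Unique.upTo⁺ (4 + k))

Unique-SYT : ∀ k → Unique (SYT-R (4 + k))
Unique-SYT k = subst Unique (sym (SYTof-filter (ribbon k) (4 + k)))
  (Unique.filter⁺ (isTableau? (ribbon k)) (Unique-perms (entries k) (Unique-entries k)))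

pred-< : ∀ {x y} → 1 ≤ x → x < y → x ∸ 1 < y ∸ 1
pred-< 1≤x x<y = ∸-monoˡ-< x<y 1≤x

pred-<-≤ : ∀ {x y} → 1 ≤ x → x ≤ y → x ∸ 1 < y
pred-<-≤ (s≤s z≤n) x≤y = x≤y

∈-rows : ∀ n a β c {x} → x ∈ rows n a β c →
         x ≡ a ⊎ (∃ λ j → j < n × x ≡ β j) ⊎ x ≡ c
∈-rows n a β c (here refl) = inj₁ refl
∈-rows n a β c (there i) with ∈-++⁻ (applyUpTo β n) i
... | inj₁ j           = inj₂ (inj₁ (∈-applyUpTo⁻ β j))
... | inj₂ (here refl) = inj₂ (inj₂ refl)

module TableauProperties {k a c xs} (t : Tableau k a c xs) where
  open Tableau t public

  top∈rows : a ∈ xs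
  top∈rows rewrite list = here refl

  row∈rows : ∀ {j} → j < 2 + k → row j ∈ xs
  row∈rows j< rewrite list = there (∈-++⁺ˡ (∈-applyUpTo⁺ row j<))

  bot∈rows : c ∈ xs
  bot∈rows rewrite list = there (∈-++⁺ʳ (applyUpTo row (2 + k)) (here refl))

  bounds : ∀ {x} → x ∈ xs → 1 ≤ x × x ≤ 4 + k
  bounds i with ∈-map⁻ suc (∈-resp-↭ standard i)
  ... | y , y∈ , refl = s≤s z≤n , ∈-upTo⁻ y∈

  -- Every value occurs, so one that is neither `a` nor `c` is forced into the middle row. This is
  -- how middle entries are recovered from the coordinates.
  locate : ∀ {x} → 1 ≤ x → x ≤ 4 + k →
           x ≡ a ⊎ (∃ λ j → j < 2 + k × x ≡ row j) ⊎ x ≡ c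
  locate {suc x} _ x≤ =
    ∈-rows (2 + k) a row c
      (subst (suc x ∈_) list (∈-resp-↭ (↭-sym standard) (∈-map⁺ suc (∈-upTo⁺ x≤))))

  unique : Unique xs
  unique = ↭ₛ.Unique-resp-↭ (setoid ℕ) (↭⇒↭ₛ (↭-sym standard)) (Unique-entries k)

  private
    unique′ : Unique (rows (2 + k) a row c)
    unique′ = subst Unique list unique

    unique-last : ∀ (ys : List ℕ) {z} → Unique (ys ++ [ z ]) → z ∉ ys
    unique-last (y ∷ ys) (y∉ ∷ _)  (here refl) = All.lookup y∉ (∈-++⁺ʳ ys (here refl)) refl
    unique-last (y ∷ ys) (_ ∷ ys!) (there i)   = unique-last ys ys! i

  top≢bot : a ≢ c
  top≢bot refl = unique-last (a ∷ applyUpTo row (2 + k)) unique′ (here refl)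

  row≢bot : ∀ {j} → j < 2 + k → row j ≢ c
  row≢bot j< e = unique-last (a ∷ applyUpTo row (2 + k)) unique′ (there (subst (_∈ _) e (∈-applyUpTo⁺ row j<)))

  row≢top : ∀ {j} → j < 2 + k → row j ≢ a
  row≢top j< e with unique′
  ... | a∉ ∷ _ = All.lookup a∉ (∈-++⁺ˡ (∈-applyUpTo⁺ row j<)) (sym e)

  row-mono : ∀ {i j} → i < j → j < 2 + k → row i < row j
  row-mono {i} {suc j} i<j j< with m≤n⇒m<n∨m≡n (s≤s⁻¹ i<j)
  ... | inj₁ i<j′ = <-trans (row-mono i<j′ (<-trans (n<1+n j) j<)) (row-step j<)
  ... | inj₂ refl = row-step j<

  row-mono-≤ : ∀ {i j} → i ≤ j → j < 2 + k → row i ≤ row j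
  row-mono-≤ i≤j j< with m≤n⇒m<n∨m≡n i≤j
  ... | inj₁ i<j  = <⇒≤ (row-mono i<j j<)
  ... | inj₂ refl = ≤-refl

-- The counterpart of `_∷ʳ_` for rows given as functions; it describes a middle row that receives m
-- at its end.
snoc : ℕ → (ℕ → ℕ) → ℕ → ℕ → ℕ
snoc n f v j with j ≟ n
... | yes _ = v
... | no  _ = f j

snoc-< : ∀ {n f v j} → j < n → snoc n f v j ≡ f j
snoc-< {n} {j = j} j<n with j ≟ n
... | yes refl = contradiction j<n (<-irrefl refl)
... | no  _    = refl

snoc-≡ : ∀ {n f v} → snoc n f v n ≡ v
snoc-≡ {n} with n ≟ n
... | yes _ = refl
... | no n≢ = contradiction refl n≢

applyUpTo-snoc : ∀ n f v → applyUpTo (snoc n f v) (suc n) ≡ applyUpTo f n ∷ʳ v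
applyUpTo-snoc n f v = trans (sym (applyUpTo-∷ʳ (snoc n f v) n))
  (cong₂ _∷ʳ_ (applyUpTo-cong n snoc-<) (snoc-≡ {n} {f} {v}))

snoc-step : ∀ {n f v} → (∀ {j} → suc j < n → f j < f (suc j)) → (∀ {j} → j < n → f j < v) →
            ∀ {j} → suc j < suc n → snoc n f v j < snoc n f v (suc j)
snoc-step {n} {f} {v} f< <v {j} j< with m≤n⇒m<n∨m≡n (s≤s⁻¹ j<)
... | inj₁ j<n  = subst₂ _<_ (sym (snoc-< (<-trans (n<1+n j) j<n))) (sym (snoc-< j<n)) (f< j<n)
... | inj₂ refl = subst₂ _<_ (sym (snoc-< (n<1+n j))) (sym (snoc-≡ {suc j} {f} {v})) (<v (n<1+n j))

-- Sliding the dot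

right-off : ∀ {k j} → 2 + k ≤ j → (1 , j) ∉ ribbon k
right-off h i with ∈-ribbon i
... | mid j< = <⇒≱ j< h

down-off : ∀ {k j} → (2 , suc j) ∉ ribbon k
down-off i with ∈-ribbon i
... | ()

top-off : ∀ {k} → (0 , 2 + k) ∉ ribbon k
top-off {k} i with ∈-ribbon i
... | ()

bot-off-right : ∀ {k} → (2 , 1) ∉ ribbon k
bot-off-right = down-off

bot-off-down : ∀ {k} → (3 , 0) ∉ ribbon k
bot-off-down i with ∈-ribbon i
... | ()

Slides : ℕ → ℕ → Filling → Cell → Cell → (Filling → Set) → Set
Slides k n f p q G = ∃ λ g → slide n (ribbon k) f p ≡ (g , q) × G g

-- The effect of a dot travelling from column j to the end of the middle row. Nothing is said of the
-- last middle box: the dot stops there and promotion overwrites it.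
RowShifted : ℕ → ℕ → Filling → Filling → Set
RowShifted k j f g =
  (∀ {i} → j ≤ i → i < suc k → g (1 , i) ≡ f (1 , suc i)) ×
  (∀ {i} → i < j → g (1 , i) ≡ f (1 , i)) ×
  g (0 , suc k) ≡ f (0 , suc k) ×
  g (2 , 0) ≡ f (2 , 0)

slide-end : ∀ {k} n f → slide n (ribbon k) f (1 , suc k) ≡ (f , (1 , suc k))
slide-end         zero    f = refl
slide-end {k} (suc n) f
  rewrite ∉-inShape (right-off {k} ≤-refl) | ∉-inShape (down-off {k} {k}) = refl

slide-bot : ∀ {k} n f → slide n (ribbon k) f (2 , 0) ≡ (f , (2 , 0))
slide-bot     zero    f = refl
slide-bot {k} (suc n) f
  rewrite ∉-inShape (bot-off-right {k}) | ∉-inShape (bot-off-down {k}) = refl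

slide-right : ∀ {k} n f j → suc j < suc k →
  slide (suc n) (ribbon k) f (1 , suc j) ≡
  slide n (ribbon k) (setF f (1 , suc j) (f (1 , 2 + j))) (1 , 2 + j)
slide-right {k} n f j j<
  rewrite ∈-inShape (mid∈ {k} (s<s j<)) | ∉-inShape (down-off {k} {j}) = refl

-- Away from column 0 a middle box has no lower neighbour, so the path is forced to the right; d is
-- the distance left to the last column.
slide-row : ∀ {k} d n j f → d + suc j ≡ suc k → d ≤ n →
            Slides k n f (1 , suc j) (1 , suc k) (RowShifted k (suc j) f)
slide-row zero n j f refl _ =
  f , slide-end n f , (λ j≤i i<j → contradiction i<j (≤⇒≯ j≤i)) , (λ _ → refl) , refl , refl
slide-row {k} (suc d) (suc n) j f e (s≤s d≤n)
  with slide-row d n (suc j) (setF f (1 , suc j) (f (1 , 2 + j))) (trans (+-suc d (suc j)) e) d≤n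
... | g , eq , after , before , top≡ , bot≡ =
  g , trans (slide-right n f j (subst (suc (suc j) ≤_) e (s≤s (m≤n+m (suc j) d)))) eq
    , shifted
    , (λ {i} i< → trans (before (m<n⇒m<1+n i<)) (setF-≢ f {1 , suc j} _ (λ { refl → <-irrefl refl i< })))
    , top≡ , bot≡
  where
  shifted : ∀ {i} → suc j ≤ i → i < suc k → g (1 , i) ≡ f (1 , suc i)
  shifted {i} j≤i i< with m≤n⇒m<n∨m≡n j≤i
  ... | inj₁ j<i  = trans (after j<i i<) (setF-≢ f {1 , suc j} _ (λ { refl → <-irrefl refl (≤-trans (n≤1+n _) j<i) }))
  ... | inj₂ refl = trans (before (n<1+n _)) (setF-≡ f (1 , suc j) _)

slide-from-left-right : ∀ {k} n f → suc k ≤ n → f (1 , 1) < f (2 , 0) →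
  Slides k n f (1 , 0) (1 , suc k) (RowShifted k 0 f)
slide-from-left-right {k} (suc n) f (s≤s k≤n) lt
  with slide-row k n 0 (setF f (1 , 0) (f (1 , 1))) (+-comm k 1) k≤n
... | g , eq , after , before , top≡ , bot≡ = g , trans step eq , shifted , (λ ()) , top≡ , bot≡
  where
  step : slide (suc n) (ribbon k) f (1 , 0) ≡ slide n (ribbon k) (setF f (1 , 0) (f (1 , 1))) (1 , 1)
  step rewrite ∈-inShape (mid∈ {k} {1} (s<s z<s)) | ∈-inShape (bot∈ k) | T⁻ (<⇒<ᵇ lt) = refl
  shifted : ∀ {i} → 0 ≤ i → i < suc k → g (1 , i) ≡ f (1 , suc i)
  -- Column 0 received its value in the first move, and the rest of the path starts to its right.
  shifted {zero}  _ _  = before z<s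
  shifted {suc i} _ i< = after (s≤s z≤n) i<

slide-from-left-down : ∀ {k} n f → 1 ≤ n → f (2 , 0) < f (1 , 1) →
  slide n (ribbon k) f (1 , 0) ≡ (setF f (1 , 0) (f (2 , 0)) , (2 , 0))
slide-from-left-down {k} (suc n) f _ lt = trans step (slide-bot n _)
  where
  step : slide (suc n) (ribbon k) f (1 , 0) ≡ slide n (ribbon k) (setF f (1 , 0) (f (2 , 0))) (2 , 0)
  step rewrite ∈-inShape (mid∈ {k} {1} (s<s z<s)) | ∈-inShape (bot∈ k)
             | not-true {f (1 , 1) <ᵇ f (2 , 0)} (λ h → <-asym lt (<ᵇ⇒< _ _ (T⁺ h))) = refl

slide-from-top : ∀ {k} n f → 1 ≤ n →
  slide n (ribbon k) f (0 , suc k) ≡ (setF f (0 , suc k) (f (1 , suc k)) , (1 , suc k))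
slide-from-top {k} (suc n) f _ = trans step (slide-end n _)
  where
  step : slide (suc n) (ribbon k) f (0 , suc k) ≡ slide n (ribbon k) (setF f (0 , suc k) (f (1 , suc k))) (1 , suc k)
  step rewrite ∉-inShape (top-off {k}) | ∈-inShape (mid∈ {k} (n<1+n (suc k))) = refl

-- One promotion step, read off from the path of the dot

length-ribbon : ∀ k → length (ribbon k) ≡ 4 + k
length-ribbon k = trans (sym (length-map (λ _ → 0) (ribbon k))) (trans (cong length (map-ribbon k (λ _ → 0)))
  (cong suc (trans (length-++ (applyUpTo (λ _ → 0) (2 + k)))
    (trans (cong (_+ 1) (length-applyUpTo (λ _ → 0) (2 + k))) (+-comm (2 + k) 1)))))

-- The starting cell and the outcome of the slide enter through equations, so that they are named
-- and not computed.
promotion-slide : ∀ sh m xs {n p g q} → length sh ≡ n → findCell sh (toFilling sh xs) 1 ≡ p →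
  slide n sh (toFilling sh xs) p ≡ (g , q) →
  promotion sh m xs ≡ map (λ d → if d ==c q then m else g d ∸ 1) sh
promotion-slide sh m xs refl refl eq rewrite eq = refl

promo-rows : ∀ {k xs p g q} a′ β′ c′ →
  findCell (ribbon k) (toFilling (ribbon k) xs) 1 ≡ p →
  slide (4 + k) (ribbon k) (toFilling (ribbon k) xs) p ≡ (g , q) →
  (∀ {d} → RibbonCell k d → (if d ==c q then 4 + k else g d ∸ 1) ≡ rowFilling a′ β′ c′ d) →
  promo (4 + k) xs ≡ rows (2 + k) a′ β′ c′
promo-rows {k} {xs} a′ β′ c′ start eq h =
  trans (promotion-slide (ribbon k) (4 + k) xs (length-ribbon k) start eq) (trans (map-ribbon k _)
    (cong₂ _∷_ (h top) (cong₂ _++_ (applyUpTo-cong (2 + k) (λ i< → h (mid i<))) (cong [_] (h bot)))))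

-- Only multisets are compared: removing 1 leaves 2, ..., m, decrementing gives 1, ..., m-1, and m
-- is added back.
standard-promoted : ∀ {k xs ys zs} → xs ↭ 1 ∷ zs → xs ↭ entries k → ys ↭ (4 + k) ∷ map pred zs → ys ↭ entries k
standard-promoted {k} {xs} {ys} {zs} p q r = ↭-trans r (↭-trans (∷↭∷ʳ (4 + k) (map pred zs))
  (↭-trans (++⁺ʳ [ 4 + k ] zs↭) (↭-reflexive eq)))
  where
  zs↭ : map pred zs ↭ applyUpTo suc (3 + k)
  zs↭ = ↭-trans (↭ₚ.map⁺ pred (drop-∷ (↭-trans (↭-sym p) q)))
    (↭-reflexive (trans (sym (map-∘ (applyUpTo suc (3 + k)))) (map-id _)))
  eq : applyUpTo suc (3 + k) ∷ʳ (4 + k) ≡ entries k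
  eq = trans (applyUpTo-∷ʳ suc (3 + k)) (sym (map-upTo suc (4 + k)))

-- Cancelling `a` and `c` leaves two middle rows that are permutations of each other, and sorted
-- permutations of each other are equal.
Tableau-injective : ∀ {k a c xs ys} → Tableau k a c xs → Tableau k a c ys → xs ≡ ys
Tableau-injective {k} {a} {c} s t = trans S.list (trans (cong (λ zs → a ∷ zs ++ [ c ]) rows≡) (sym T.list))
  where
  module S = TableauProperties s
  module T = TableauProperties t
  middle↭ : ∀ {xs ys zs : List ℕ} → xs ++ [ c ] ↭ ys ++ [ c ] → xs ↭ ys
  middle↭ {xs} {ys} p = drop-∷ (↭-trans (∷↭∷ʳ c xs) (↭-trans p (↭-sym (∷↭∷ʳ c ys))))
  rows↭ : applyUpTo S.row (2 + k) ↭ applyUpTo T.row (2 + k)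
  rows↭ = middle↭ {zs = []} (drop-∷ (subst₂ _↭_ S.list T.list (↭-trans S.standard (↭-sym T.standard))))
  rows≡ : applyUpTo S.row (2 + k) ≡ applyUpTo T.row (2 + k)
  rows≡ = Pointwise-≡⇒≡ (↗↭↗⇒≋ ≤-totalOrder
    (applyUpTo⁺₁ ≤-totalOrder S.row (2 + k) (<⇒≤ ∘ S.row-step))
    (applyUpTo⁺₁ ≤-totalOrder T.row (2 + k) (<⇒≤ ∘ T.row-step)) (↭⇒↭ₛ rows↭))

module Promotion {k a c xs} (t : Tableau k a c xs) where
  open TableauProperties t

  f : Filling
  f = toFilling (ribbon k) xs

  at : ∀ {d} → RibbonCell k d → f d ≡ rowFilling a row c d
  at {d} i = trans (cong (λ ys → toFilling (ribbon k) ys d) list) (rows-filling k a row c i)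

  private
    at-top : f (0 , suc k) ≡ a
    at-top = at top
    at-bot : f (2 , 0) ≡ c
    at-bot = at bot
    at-row : ∀ {j} → j < 2 + k → f (1 , j) ≡ row j
    at-row = at ∘ mid

    1≤row : ∀ {j} → j < 2 + k → 1 ≤ row j
    1≤row j< = proj₁ (bounds (row∈rows j<))

    row≤ : ∀ {j} → j < 2 + k → row j ≤ 4 + k
    row≤ j< = proj₂ (bounds (row∈rows j<))

    pred-step : ∀ {i j} → i < j → j < 2 + k → row i ∸ 1 < row j ∸ 1
    pred-step i<j j< = pred-< (1≤row (<-trans i<j j<)) (row-mono i<j j<)

    pred-bound : ∀ {j} → j < 2 + k → row j ∸ 1 < 4 + k
    pred-bound j< = pred-<-≤ (1≤row j<) (row≤ j<)

    1≤a : 1 ≤ a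
    1≤a = proj₁ (bounds top∈rows)
    1≤c : 1 ≤ c
    1≤c = proj₁ (bounds bot∈rows)

    start-row : row 0 ≡ 1 → findCell (ribbon k) f 1 ≡ (1 , 0)
    start-row e = findCell-first (ribbon k) f (mid∈ z<s) (trans (at-row z<s) e)
      (λ i fe → only (∈-ribbon i) (trans (sym (at (∈-ribbon i))) fe))
      where
      only : ∀ {d} → RibbonCell k d → rowFilling a row c d ≡ 1 → d ≡ (1 , 0)
      only top a≡1 = contradiction (trans e (sym a≡1)) (row≢top z<s)
      only (mid {zero}  j<) _  = refl
      only (mid {suc j} j<) re = contradiction (row-mono z<s j<) (<-irrefl (trans e (sym re)))
      only bot c≡1 = contradiction (trans e (sym c≡1)) (row≢bot z<s)

    start-top : a ≡ 1 → findCell (ribbon k) f 1 ≡ (0 , suc k)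
    start-top e = findCell-first (ribbon k) f (top∈ k) (trans at-top e)
      (λ i fe → only (∈-ribbon i) (trans (sym (at (∈-ribbon i))) fe))
      where
      only : ∀ {d} → RibbonCell k d → rowFilling a row c d ≡ 1 → d ≡ (0 , suc k)
      only top _ = refl
      only (mid j<) re = contradiction (trans re (sym e)) (row≢top j<)
      only bot c≡1 = contradiction (trans e (sym c≡1)) top≢bot

    -- All entries but 1, when 1 is the first entry of the middle row.
    others : List ℕ
    others = a ∷ applyUpTo (row ∘ suc) (suc k) ++ [ c ]

    xs↭others : row 0 ≡ 1 → xs ↭ 1 ∷ others
    xs↭others e = ↭-trans (↭-reflexive (trans list (cong (λ z → a ∷ z ∷ applyUpTo (row ∘ suc) (suc k) ++ [ c ]) e)))
                          (↭-swap a 1 ↭-refl)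

    pred-others : map pred others ≡ pred a ∷ applyUpTo (λ j → pred (row (suc j))) (suc k) ++ [ pred c ]
    pred-others = cong (pred a ∷_) (trans (map-++ pred (applyUpTo (row ∘ suc) (suc k)) [ c ])
      (cong (_++ [ pred c ]) (map-applyUpTo (row ∘ suc) pred (suc k))))

    ∷ʳ-++-↭ : ∀ (ys : List ℕ) v zs → (ys ∷ʳ v) ++ zs ↭ v ∷ ys ++ zs
    ∷ʳ-++-↭ ys v zs = ↭-trans (↭-reflexive (++-assoc ys [ v ] zs)) (shift v ys zs)

  -- The dot runs through the whole middle row, so the outer boxes are merely decremented; the
  -- condition at the top box survives because m now stands below it.
  promote-right : row 0 ≡ 1 → row 1 < c → Tableau k (a ∸ 1) (c ∸ 1) (promo (4 + k) xs)
  promote-right e r<c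
    with slide-from-left-right {k} (4 + k) f (m≤n+m (suc k) 3)
           (subst₂ _<_ (sym (at-row (s<s z<s))) (sym at-bot) r<c)
  ... | g , eq , shifted , _ , top≡ , bot≡ =
    tableau β′ promoted (standard-promoted (xs↭others e) standard perm)
      (snoc-step (λ h → pred-step (n<1+n _) (s<s h)) (pred-bound ∘ s<s))
      (subst (a ∸ 1 <_) (sym last≡) (pred-<-≤ 1≤a (proj₂ (bounds top∈rows))))
      (pred-< (1≤row (s<s z<s)) r<c)
    where
    β′ : ℕ → ℕ
    β′ = snoc (suc k) (λ j → row (suc j) ∸ 1) (4 + k)
    last≡ : β′ (suc k) ≡ 4 + k
    last≡ = snoc-≡ {suc k} {λ j → row (suc j) ∸ 1}
    values : ∀ {d} → RibbonCell k d →
             (if d ==c (1 , suc k) then 4 + k else g d ∸ 1) ≡ rowFilling (a ∸ 1) β′ (c ∸ 1) d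
    values top = cong (_∸ 1) (trans top≡ at-top)
    values bot = cong (_∸ 1) (trans bot≡ at-bot)
    values (mid {j} j<) with m≤n⇒m<n∨m≡n (s≤s⁻¹ j<)
    ... | inj₂ refl = trans (if-== (1 , suc k)) (sym last≡)
    ... | inj₁ j<k =
      trans (if-≢ (1 , j) (1 , suc k) (λ { refl → <-irrefl refl j<k }))
        (trans (cong (_∸ 1) (trans (shifted z≤n j<k) (at-row (s<s j<k)))) (sym (snoc-< j<k)))
    promoted : promo (4 + k) xs ≡ rows (2 + k) (a ∸ 1) β′ (c ∸ 1)
    promoted = promo-rows {xs = xs} (a ∸ 1) β′ (c ∸ 1) (start-row e) eq values
    perm : promo (4 + k) xs ↭ 4 + k ∷ map pred others
    perm = ↭-trans (↭-reflexive (trans promoted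
             (cong (λ ys → a ∸ 1 ∷ ys ++ [ c ∸ 1 ]) (applyUpTo-snoc (suc k) _ (4 + k)))))
      (↭-trans (↭-prep _ (∷ʳ-++-↭ (applyUpTo (λ j → row (suc j) ∸ 1) (suc k)) (4 + k) [ c ∸ 1 ]))
      (↭-trans (↭-swap _ _ ↭-refl) (↭-prep _ (↭-reflexive (sym pred-others)))))

  -- The bottom entry moves up into the first middle box and m takes its place; `c < row 1` is what
  -- keeps the row increasing.
  promote-down : row 0 ≡ 1 → c < row 1 → Tableau k (a ∸ 1) (4 + k) (promo (4 + k) xs)
  promote-down e c<r =
    tableau β′ promoted (standard-promoted (xs↭others e) standard perm) step
      (pred-< 1≤a top<last) (pred-<-≤ 1≤c (proj₂ (bounds bot∈rows)))
    where
    β′ : ℕ → ℕ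
    β′ zero    = c ∸ 1
    β′ (suc j) = row (suc j) ∸ 1
    step : ∀ {j} → suc j < 2 + k → β′ j < β′ (suc j)
    step {zero}  _ = pred-< 1≤c c<r
    step {suc j} h = pred-step (n<1+n _) h
    values : ∀ {d} → RibbonCell k d →
             (if d ==c (2 , 0) then 4 + k else setF f (1 , 0) (f (2 , 0)) d ∸ 1) ≡ rowFilling (a ∸ 1) β′ (4 + k) d
    values top = cong (_∸ 1) at-top
    values bot = refl
    values (mid {zero} j<)  = cong (_∸ 1) at-bot
    values (mid {suc j} j<) = cong (_∸ 1) (at-row j<)
    promoted : promo (4 + k) xs ≡ rows (2 + k) (a ∸ 1) β′ (4 + k)
    promoted = promo-rows {xs = xs} (a ∸ 1) β′ (4 + k) (start-row e)
      (slide-from-left-down {k} (4 + k) f (s≤s z≤n) (subst₂ _<_ (sym at-bot) (sym (at-row (s<s z<s))) c<r)) values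
    perm : promo (4 + k) xs ↭ 4 + k ∷ map pred others
    perm = ↭-trans (↭-reflexive promoted)
      (↭-trans (↭-sym (∷↭∷ʳ (4 + k) (a ∸ 1 ∷ applyUpTo β′ (2 + k)))) (↭-prep _
      (↭-trans (↭-prep _ (∷↭∷ʳ (c ∸ 1) (applyUpTo (λ j → row (suc j) ∸ 1) (suc k)))) (↭-reflexive (sym pred-others)))))

  -- The last middle entry rises into the top box. Its value is not a coordinate and has to be
  -- determined separately.
  promote-top : a ≡ 1 → Tableau k (row (suc k) ∸ 1) (c ∸ 1) (promo (4 + k) xs)
  promote-top e =
    tableau β′ promoted (standard-promoted
      (↭-reflexive (trans list (cong (_∷ applyUpTo row (2 + k) ++ [ c ]) e))) standard perm)
      (snoc-step (λ h → pred-step (n<1+n _) (m<n⇒m<1+n h)) (pred-bound ∘ m<n⇒m<1+n))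
      (subst (row (suc k) ∸ 1 <_) (sym last≡) (pred-bound (n<1+n (suc k))))
      (pred-< (1≤row z<s) first<bot)
    where
    β′ : ℕ → ℕ
    β′ = snoc (suc k) (λ j → row j ∸ 1) (4 + k)
    last≡ : β′ (suc k) ≡ 4 + k
    last≡ = snoc-≡ {suc k} {λ j → row j ∸ 1}
    values : ∀ {d} → RibbonCell k d →
             (if d ==c (1 , suc k) then 4 + k else setF f (0 , suc k) (f (1 , suc k)) d ∸ 1)
             ≡ rowFilling (row (suc k) ∸ 1) β′ (c ∸ 1) d
    values top = cong (_∸ 1) (trans (setF-≡ f (0 , suc k) _) (at-row (n<1+n (suc k))))
    values bot = cong (_∸ 1) at-bot
    values (mid {j} j<) with m≤n⇒m<n∨m≡n (s≤s⁻¹ j<)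
    ... | inj₂ refl = trans (if-== (1 , suc k)) (sym last≡)
    ... | inj₁ j<k =
      trans (if-≢ (1 , j) (1 , suc k) (λ { refl → <-irrefl refl j<k }))
        (trans (cong (_∸ 1) (at-row j<)) (sym (snoc-< j<k)))
    promoted : promo (4 + k) xs ≡ rows (2 + k) (row (suc k) ∸ 1) β′ (c ∸ 1)
    promoted = promo-rows {xs = xs} (row (suc k) ∸ 1) β′ (c ∸ 1) (start-top e) (slide-from-top {k} (4 + k) f (s≤s z≤n)) values
    pred-row : map pred (applyUpTo row (2 + k) ++ [ c ]) ≡ (applyUpTo (λ j → row j ∸ 1) (suc k) ∷ʳ (row (suc k) ∸ 1)) ++ [ c ∸ 1 ]
    pred-row = trans (map-++ pred (applyUpTo row (2 + k)) [ c ])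
      (cong (_++ [ c ∸ 1 ]) (trans (map-applyUpTo row pred (2 + k)) (sym (applyUpTo-∷ʳ (λ j → row j ∸ 1) (suc k)))))
    perm : promo (4 + k) xs ↭ 4 + k ∷ map pred (applyUpTo row (2 + k) ++ [ c ])
    perm = ↭-trans (↭-reflexive (trans promoted
             (cong (λ ys → row (suc k) ∸ 1 ∷ ys ++ [ c ∸ 1 ]) (applyUpTo-snoc (suc k) _ (4 + k)))))
      (↭-trans (↭-prep _ (∷ʳ-++-↭ (applyUpTo (λ j → row j ∸ 1) (suc k)) (4 + k) [ c ∸ 1 ]))
      (↭-trans (↭-swap _ _ ↭-refl) (↭-prep _
      (↭-trans (↭-sym (∷ʳ-++-↭ (applyUpTo (λ j → row j ∸ 1) (suc k)) (row (suc k) ∸ 1) [ c ∸ 1 ]))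
               (↭-reflexive (sym pred-row))))))

-- Bounds on the coordinates, and middle entries recovered from them

module Coordinates {k a c xs} (t : Tableau k a c xs) where
  open TableauProperties t

  last≤ : row (suc k) ≤ 4 + k
  last≤ = proj₂ (bounds (row∈rows (n<1+n (suc k))))

  1≤first : 1 ≤ row 0
  1≤first = proj₁ (bounds (row∈rows z<s))

  1≤a : 1 ≤ a
  1≤a = proj₁ (bounds top∈rows)

  a≤ : a ≤ 3 + k
  a≤ = s≤s⁻¹ (<-≤-trans top<last last≤)

  2≤c : 2 ≤ c
  2≤c = ≤-<-trans 1≤first first<bot

  c≤ : c ≤ 4 + k
  c≤ = proj₂ (bounds bot∈rows)

  -- The first middle entry, being below 2, would also be 1.
  not-1-2 : a ≡ 1 → c ≢ 2
  not-1-2 refl refl = row≢top z<s (≤-antisym (s≤s⁻¹ first<bot) 1≤first)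

  -- The last middle entry, being above m-1, would also be m.
  not-both-max : a ≡ 3 + k → c ≢ 4 + k
  not-both-max refl refl = <⇒≱ top<last (s≤s⁻¹ (≤∧≢⇒< last≤ (row≢bot (n<1+n (suc k)))))

  first≡1 : a ≢ 1 → row 0 ≡ 1
  first≡1 a≢1 with locate {1} ≤-refl (s≤s z≤n)
  ... | inj₁ e                   = contradiction (sym e) a≢1
  ... | inj₂ (inj₁ (j , j< , e)) = ≤-antisym (subst (row 0 ≤_) (sym e) (row-mono-≤ z≤n j<)) 1≤first
  ... | inj₂ (inj₂ refl)         = contradiction 2≤c (<-irrefl refl)

  -- An upper bound of the row that is not a coordinate lies in the row itself, hence is its last
  -- entry.
  last-attained : ∀ {x} → x ≢ a → x ≢ c → 1 ≤ x → row (suc k) ≤ x → x ≤ 4 + k → row (suc k) ≡ x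
  last-attained x≢a x≢c 1≤x last≤x x≤ with locate 1≤x x≤
  ... | inj₁ e                   = contradiction e x≢a
  ... | inj₂ (inj₁ (j , j< , e)) = ≤-antisym last≤x (subst (_≤ row (suc k)) (sym e) (row-mono-≤ (s≤s⁻¹ j<) (n<1+n (suc k))))
  ... | inj₂ (inj₂ e)            = contradiction e x≢c

  -- Such an `x` lies in the middle row, and not in its first box.
  second≤ : ∀ {x} → x ≢ a → x ≢ c → row 0 < x → x ≤ 4 + k → row 1 ≤ x
  second≤ x≢a x≢c <x x≤ with locate (≤-trans 1≤first (<⇒≤ <x)) x≤
  ... | inj₁ e                          = contradiction e x≢a
  ... | inj₂ (inj₁ (zero  , j< , refl)) = contradiction <x (<-irrefl refl)
  ... | inj₂ (inj₁ (suc j , j< , refl)) = row-mono-≤ (s≤s z≤n) j<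
  ... | inj₂ (inj₂ e)                   = contradiction e x≢c

  first<second : row 0 < row 1
  first<second = row-step (s<s z<s)

Tableau-top : ∀ {k a a′ c c′ xs} → Tableau k a c xs → Tableau k a′ c′ xs → a ≡ a′
Tableau-top s t = ∷-injectiveˡ (trans (sym (Tableau.list s)) (Tableau.list t))

Tableau-bot : ∀ {k a a′ c c′ xs} → Tableau k a c xs → Tableau k a′ c′ xs → c ≡ c′
Tableau-bot {k} s t = ∷ʳ-injectiveʳ (applyUpTo (Tableau.row s) (2 + k)) (applyUpTo (Tableau.row t) (2 + k))
  (∷-injectiveʳ (trans (sym (Tableau.list s)) (Tableau.list t)))

-- Opaque, since comparing iterates of promo would unfold the slides.
opaque
  ∂ : ℕ → List ℕ → List ℕ
  ∂ k = promo (4 + k)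

  ∂-promo : ∀ k → ∂ k ≡ promo (4 + k)
  ∂-promo k = refl

  -- The hypotheses describe the target. Excluding the target (1 , 2) excludes the source (2 , 3),
  -- where the dot would go down.
  promote-generic : ∀ {k a c xs} → 1 ≤ a → 2 ≤ c → (a ≡ 1 → c ≢ 2) →
                    Tableau k (suc a) (suc c) xs → Tableau k a c (∂ k xs)
  promote-generic {k} {suc a} {c} a≥1 c≥2 ≢1-2 t = promote-right first (second a refl)
    where
    open Promotion t
    open Tableau t
    open Coordinates t
    first : row 0 ≡ 1
    first = first≡1 λ ()
    second : ∀ b → a ≡ b → row 1 < suc c
    -- The source has top entry 2, so 3 is the least candidate for the second middle entry; it is
    -- not the bottom entry because `c` is not 2.
    second zero refl = ≤-<-trans
      (second≤ {3} (λ ()) (λ e → ≢1-2 refl (sym (suc-injective e))) (subst (_< 3) (sym first) (s≤s (s≤s z≤n))) (s≤s (s≤s (s≤s z≤n))))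
      (s≤s (≤∧≢⇒< c≥2 (≢1-2 refl ∘ sym)))
    -- With top entry at least 3 and bottom entry at least 3, the value 2 is in the row.
    second (suc b) refl = ≤-<-trans
      (second≤ {2} (λ ()) (<⇒≢ (s≤s c≥2)) (subst (_< 2) (sym first) (s≤s (s≤s z≤n))) (s≤s (s≤s z≤n)))
      (s≤s c≥2)

  promote-wrap-bot : ∀ {k a xs} → 1 ≤ a → Tableau k (suc a) 2 xs → Tableau k a (4 + k) (∂ k xs)
  promote-wrap-bot {k} {suc a} _ t = promote-down first
    (≤∧≢⇒< (subst (_< row 1) first first<second) (λ e → row≢bot (s<s z<s) (sym e)))
    where
    open Promotion t
    open TableauProperties t
    open Coordinates t
    first : row 0 ≡ 1
    first = first≡1 λ ()

  -- Both 2 and 3 lie outside the middle row, so its second entry exceeds the bottom entry 3.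
  promote-2-3 : ∀ {k xs} → Tableau k 2 3 xs → Tableau k 1 (4 + k) (∂ k xs)
  promote-2-3 {k} t = promote-down first
    (≤∧≢⇒< (≤∧≢⇒< (subst (_< row 1) first first<second) (λ e → row≢top (s<s z<s) (sym e)))
           (λ e → row≢bot (s<s z<s) (sym e)))
    where
    open Promotion t
    open TableauProperties t
    open Coordinates t
    first : row 0 ≡ 1
    first = first≡1 λ ()

  promote-wrap-top : ∀ {k c xs} → c ≢ 3 + k → Tableau k 1 (suc c) xs → Tableau k (3 + k) c (∂ k xs)
  promote-wrap-top {k} {c} {xs} c≢ t = subst (λ b → Tableau k (b ∸ 1) c (∂ k xs)) last (promote-top refl)
    where
    open Promotion t
    open TableauProperties t
    open Coordinates t
    last : row (suc k) ≡ 4 + k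
    last = last-attained (λ ()) (λ e → c≢ (sym (suc-injective e))) (s≤s z≤n) last≤ ≤-refl

  -- With m in the bottom box the middle row ends in m-1, so the new top entry is m-2.
  promote-wrap-both : ∀ {k xs} → Tableau k 1 (4 + k) xs → Tableau k (2 + k) (3 + k) (∂ k xs)
  promote-wrap-both {k} {xs} t = subst (λ b → Tableau k (b ∸ 1) (3 + k) (∂ k xs)) last (promote-top refl)
    where
    open Promotion t
    open TableauProperties t
    open Coordinates t
    last : row (suc k) ≡ 3 + k
    last = last-attained (λ ()) (<⇒≢ (n<1+n _)) (s≤s z≤n)
      (s≤s⁻¹ (≤∧≢⇒< last≤ (row≢bot (n<1+n (suc k))))) (n≤1+n _)

-- The side condition is needed for the final pair only: all earlier targets have top entry at least
-- 2.
descend : ∀ {k} j {a c xs} → 1 ≤ a → 2 ≤ c → (a ≡ 1 → c ≢ 2) →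
          Tableau k (j + a) (j + c) xs → Tableau k a c (iter j (∂ k) xs)
descend zero    _   _   _       t = t
descend {k} (suc j) {a} {c} {xs} 1≤a 2≤c not-1-2 t = promote-generic 1≤a 2≤c not-1-2
  (descend j (m≤n⇒m≤1+n 1≤a) (m≤n⇒m≤1+n 2≤c) (λ e → contradiction 1≤a (<⇒≱ (≤-reflexive e)))
    (subst₂ (λ x y → Tableau k x y xs) (sym (+-suc j a)) (sym (+-suc j c)) t))

iter-+ : ∀ {A : Set} i j (f : A → A) x → iter (i + j) f x ≡ iter i f (iter j f x)
iter-+ zero    j f x = refl
iter-+ (suc i) j f x = cong f (iter-+ i j f x)

-- Base points of the orbits

-- The increasing enumeration of the naturals other than its first argument.
skip : ℕ → ℕ → ℕ
skip zero    j       = suc j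
skip (suc v) zero    = zero
skip (suc v) (suc j) = suc (skip v j)

skip-step : ∀ v j → skip v j < skip v (suc j)
skip-step zero          j       = n<1+n (suc j)
skip-step (suc zero)    zero    = z<s
skip-step (suc (suc v)) zero    = z<s
skip-step (suc v)       (suc j) = s<s (skip-step v j)

skip-↭ : ∀ {v n} → v ≤ n → v ∷ applyUpTo (skip v) n ↭ upTo (suc n)
skip-↭ {zero}  {n}     _         = ↭-refl
skip-↭ {suc v} {suc n} (s≤s v≤n) = ↭-trans (↭-swap _ _ ↭-refl) (↭-prep 0
  (↭-trans (↭-reflexive (sym (cong (suc v ∷_) (map-applyUpTo (skip v) suc n))))
  (↭-trans (↭ₚ.map⁺ suc (skip-↭ v≤n)) (↭-reflexive (map-upTo suc (suc n))))))

-- The tableau (1 , 3+p), whose middle row is 2, ..., m without 3+p. The index p runs from 0 to k+1,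
-- and p = k+1 is the exceptional pair (1 , m).
base : ℕ → ℕ → List ℕ
base k p = rows (2 + k) 1 (λ j → 2 + skip (suc p) j) (3 + p)

base-Tableau : ∀ {k p} → p ≤ suc k → Tableau k 1 (3 + p) (base k p)
base-Tableau {k} {p} p≤ = tableau _ refl std (λ {j} _ → s<s (s<s (skip-step (suc p) j)))
  (s≤s (s≤s z≤n)) (s≤s (s≤s (s≤s z≤n)))
  where
  std : base k p ↭ entries k
  std = ↭-prep 1 (↭-trans (↭-sym (∷↭∷ʳ (3 + p) (applyUpTo (λ j → 2 + skip (suc p) j) (2 + k))))
    (↭-trans (↭-reflexive (sym (cong (3 + p ∷_) (map-applyUpTo (skip (suc p)) (λ i → 2 + i) (2 + k)))))
    (↭-trans (↭ₚ.map⁺ (λ i → 2 + i) (skip-↭ (s≤s p≤)))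
             (↭-reflexive (trans (map-upTo (λ i → 2 + i) (3 + k)) (sym (map-applyUpTo suc suc (3 + k))))))))

-- The two parts of a generic orbit, cut where the bottom entry wraps around.
module _ {k p q xs} (k≡ : k ≡ p + q) (t : Tableau k 1 (3 + p) xs) where

  -- One step wraps the top entry to m-1, then both coordinates fall; `e` counts the descents left
  -- until the bottom entry is 2.
  generic₁ : ∀ j e → j + e ≡ p → Tableau k (3 + e + q) (2 + e) (iter (j + 1) (∂ k) xs)
  generic₁ j e refl = subst (Tableau k _ _) (sym (iter-+ j 1 (∂ k) xs))
    (descend j (s≤s z≤n) (s≤s (s≤s z≤n)) (λ ()) (subst₂ (λ a c → Tableau k a c (∂ k xs)) a≡ c≡ (promote-wrap-top p≢ t)))
    where
    p≢ : 2 + (j + e) ≢ 3 + k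
    p≢ eq = <⇒≢ (s≤s (s≤s (s≤s (subst (j + e ≤_) (sym k≡) (m≤m+n (j + e) q))))) eq
    a≡ : 3 + k ≡ j + (3 + e + q)
    a≡ = trans (cong (λ i → 3 + i) k≡) (shuffle j e q)
      where
      shuffle : ∀ j e q → 3 + (j + e + q) ≡ j + (3 + e + q)
      shuffle = solve-∀
    c≡ : 2 + (j + e) ≡ j + (2 + e)
    c≡ = shuffle j e
      where
      shuffle : ∀ j e → 2 + (j + e) ≡ j + (2 + e)
      shuffle = solve-∀

  -- The offset 2+p consists of the wrap of the top entry, p descents and the wrap of the bottom
  -- entry to m; `e` counts the descents left until the top entry is 1 again.
  generic₂ : ∀ j e → j + e ≡ suc q → Tableau k (suc e) (3 + p + e) (iter (j + (2 + p)) (∂ k) xs)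
  generic₂ j e eq = subst (Tableau k _ _) (sym (iter-+ j (2 + p) (∂ k) xs))
    (descend j (s≤s z≤n) (s≤s (s≤s z≤n)) (λ _ ())
      (subst₂ (λ a c → Tableau k a c (iter (2 + p) (∂ k) xs)) a≡ c≡
        (promote-wrap-bot (s≤s z≤n) (subst (λ i → Tableau k (3 + q) 2 (iter i (∂ k) xs)) (+-comm p 1) (generic₁ p 0 (+-identityʳ p))))))
    where
    a≡ : 2 + q ≡ j + suc e
    a≡ = trans (cong suc (sym eq)) (sym (+-suc j e))
    shuffle₁ : ∀ p q → 4 + (p + q) ≡ 3 + (p + suc q)
    shuffle₁ = solve-∀
    shuffle₂ : ∀ p j e → 3 + (p + (j + e)) ≡ j + (3 + p + e)
    shuffle₂ = solve-∀
    c≡ : 4 + k ≡ j + (3 + p + e)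
    c≡ = trans (cong (λ i → 4 + i) k≡) (trans (shuffle₁ p q) (trans (cong (λ r → 3 + (p + r)) (sym eq)) (shuffle₂ p j e)))

module _ {k xs} (t : Tableau k 1 (4 + k) xs) where

  special : ∀ j e → j + e ≡ k → Tableau k (2 + e) (3 + e) (iter (j + 1) (∂ k) xs)
  special j e eq = subst (Tableau k _ _) (sym (iter-+ j 1 (∂ k) xs))
    (descend j (s≤s z≤n) (s≤s (s≤s z≤n)) (λ ())
      (subst₂ (λ a c → Tableau k a c (∂ k xs)) (shift₂ eq) (shift₃ eq) (promote-wrap-both t)))
    where
    shift₂ : ∀ {k} → j + e ≡ k → 2 + k ≡ j + (2 + e)
    shift₂ refl = shuffle j e
      where
      shuffle : ∀ j e → 2 + (j + e) ≡ j + (2 + e)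
      shuffle = solve-∀
    shift₃ : ∀ {k} → j + e ≡ k → 3 + k ≡ j + (3 + e)
    shift₃ refl = shuffle j e
      where
      shuffle : ∀ j e → 3 + (j + e) ≡ j + (3 + e)
      shuffle = solve-∀

  -- One step to (m-2 , m-1), then k = m-4 descents to (2 , 3), and one step back: m-2 in all.
  special-closed : Tableau k 1 (4 + k) (iter (2 + k) (∂ k) xs)
  special-closed = promote-2-3 (subst (λ i → Tableau k 2 3 (iter i (∂ k) xs)) (+-comm k 1) (special k 0 (+-identityʳ k)))

-- Iteration along a cycle

module _ {A : Set} (f : A → A) where

  iter-comm : ∀ i j x → iter i f (iter j f x) ≡ iter j f (iter i f x)
  iter-comm i j x = trans (sym (iter-+ i j f x)) (trans (cong (λ l → iter l f x) (+-comm i j)) (iter-+ j i f x))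

  iter-multiple : ∀ {n x} → iter n f x ≡ x → ∀ q → iter (q * n) f x ≡ x
  iter-multiple         closed zero    = refl
  iter-multiple {n} {x} closed (suc q) =
    trans (iter-+ n (q * n) f x) (trans (cong (iter n f) (iter-multiple closed q)) closed)

  iter-mod : ∀ {n x} .{{_ : NonZero n}} → iter n f x ≡ x → ∀ l → iter l f x ≡ iter (l % n) f x
  iter-mod {n} {x} closed l = trans (cong (λ j → iter j f x) (m≡m%n+[m/n]*n l n))
    (trans (iter-+ (l % n) (l / n * n) f x) (cong (iter (l % n) f) (iter-multiple closed (l / n))))

  module _ {n x} .{{_ : NonZero n}} (closed : iter n f x ≡ x) (minimal : ∀ {i} → 0 < i → i < n → iter i f x ≢ x) where

    fixed⇒∣ : ∀ {l} → iter l f x ≡ x → n ∣ l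
    fixed⇒∣ {l} fixed with l % n in eq | m%n<n l n | trans (sym (iter-mod closed l)) fixed
    ... | zero  | _ | _ = m%n≡0⇒n∣m l n eq
    ... | suc r | r<n | fixed′ = contradiction fixed′ (minimal z<s r<n)

    -- Completing the cycle from the i-th point returns to `x` and commutes with the l-th iterate,
    -- so the claim reduces to `x`.
    orbit-fixed⇒∣ : ∀ {i l} → i < n → iter l f (iter i f x) ≡ iter i f x → n ∣ l
    orbit-fixed⇒∣ {i} {l} i<n fixed = fixed⇒∣ (begin
      iter l f x                               ≡⟨ cong (iter l f) back ⟨
      iter l f (iter (n ∸ i) f (iter i f x))   ≡⟨ iter-comm l (n ∸ i) _ ⟩
      iter (n ∸ i) f (iter l f (iter i f x))   ≡⟨ cong (iter (n ∸ i) f) fixed ⟩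
      iter (n ∸ i) f (iter i f x)              ≡⟨ back ⟩
      x                                        ∎)
      where
      open ≡-Reasoning
      back : iter (n ∸ i) f (iter i f x) ≡ x
      back = trans (sym (iter-+ (n ∸ i) i f x)) (trans (cong (λ j → iter j f x) (m∸n+n≡m (<⇒≤ i<n))) closed)

    ∣⇒orbit-fixed : ∀ {i l} → n ∣ l → iter l f (iter i f x) ≡ iter i f x
    ∣⇒orbit-fixed {i} (divides q refl) = trans (iter-comm (q * n) i x) (cong (iter i f) (iter-multiple closed q))

    orbit-unique : Unique (applyUpTo (λ i → iter i f x) n)
    orbit-unique = Unique.applyUpTo⁺₁ _ n λ {i} {j} i<j j<n e →
      minimal (m<n⇒0<n∸m i<j) (≤-<-trans (m∸n≤m j i) j<n) (returns i<j j<n e)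
      where
      returns : ∀ {i j} → i < j → j < n → iter i f x ≡ iter j f x → iter (j ∸ i) f x ≡ x
      returns {i} {j} i<j j<n e = begin
        iter (j ∸ i) f x                            ≡⟨ cong (iter (j ∸ i) f) closed ⟨
        iter (j ∸ i) f (iter n f x)                 ≡⟨ iter-+ (j ∸ i) n f x ⟨
        iter (j ∸ i + n) f x                        ≡⟨ cong (λ l → iter l f x) eq ⟩
        iter (n ∸ i + j) f x                        ≡⟨ iter-+ (n ∸ i) j f x ⟩
        iter (n ∸ i) f (iter j f x)                 ≡⟨ cong (iter (n ∸ i) f) e ⟨
        iter (n ∸ i) f (iter i f x)                 ≡⟨ iter-+ (n ∸ i) i f x ⟨
        iter (n ∸ i + i) f x                        ≡⟨ cong (λ l → iter l f x) (m∸n+n≡m i≤n) ⟩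
        iter n f x                                  ≡⟨ closed ⟩
        x                                           ∎
        where
        open ≡-Reasoning
        i≤n : i ≤ n
        i≤n = <⇒≤ (<-trans i<j j<n)
        eq : j ∸ i + n ≡ n ∸ i + j
        eq = trans (sym (+-∸-comm n (<⇒≤ i<j))) (trans (cong (_∸ i) (+-comm j n)) (+-∸-comm j i≤n))

-- The orbits of promotion

orbitSize : ℕ → ℕ → ℕ
orbitSize k p with p ≟ suc k
... | yes _ = 2 + k
... | no  _ = 3 + k

orbitSize-special : ∀ k → orbitSize k (suc k) ≡ 2 + k
orbitSize-special k with suc k ≟ suc k
... | yes _ = refl
... | no ≢  = contradiction refl ≢

orbitSize-generic : ∀ {k p} → p ≤ k → orbitSize k p ≡ 3 + k
orbitSize-generic {k} {p} p≤k with p ≟ suc k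
... | yes refl = contradiction p≤k (<⇒≱ (n<1+n k))
... | no _     = refl

orbitSize-nonZero : ∀ k p → NonZero (orbitSize k p)
orbitSize-nonZero k p with p ≟ suc k
... | yes _ = _
... | no  _ = _

generic-closed : ∀ {k p} → p ≤ k → iter (3 + k) (∂ k) (base k p) ≡ base k p
generic-closed {k} {p} p≤k =
  Tableau-injective (subst₂ (λ c l → Tableau k 1 c (iter l (∂ k) (base k p))) (cong (λ i → 3 + i) (+-identityʳ p)) len
    (generic₂ k≡ t (suc q) 0 (+-identityʳ (suc q)))) t
  where
  q : ℕ
  q = k ∸ p
  k≡ : k ≡ p + q
  k≡ = sym (m+[n∸m]≡n p≤k)
  t : Tableau k 1 (3 + p) (base k p)
  t = base-Tableau (m≤n⇒m≤1+n p≤k)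
  shuffle : ∀ p q → suc q + (2 + p) ≡ 3 + (p + q)
  shuffle = solve-∀
  len : suc q + (2 + p) ≡ 3 + k
  len = trans (shuffle p q) (cong (λ i → 3 + i) (sym k≡))

orbit-closed : ∀ {k p} → p ≤ suc k → iter (orbitSize k p) (∂ k) (base k p) ≡ base k p
orbit-closed {k} {p} p≤ with p ≟ suc k
... | yes refl = Tableau-injective (special-closed (base-Tableau p≤)) (base-Tableau p≤)
... | no p≢    = generic-closed (s≤s⁻¹ (≤∧≢⇒< p≤ p≢))

reindex : ∀ {k a c xs i j} → i ≡ j → Tableau k a c (iter i (∂ k) xs) → Tableau k a c (iter j (∂ k) xs)
reindex refl t = t

generic-top : ∀ {k p i} → p ≤ k → 0 < i → i < 3 + k →
              ∃₂ λ a c → 2 ≤ a × Tableau k a c (iter i (∂ k) (base k p))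
generic-top {k} {p} {suc i} p≤k _ i< with suc i ≤? suc p
... | yes i≤p = _ , _ , s≤s (s≤s z≤n) ,
  reindex (+-comm i 1)
    (generic₁ (sym (m+[n∸m]≡n p≤k)) (base-Tableau (m≤n⇒m≤1+n p≤k)) i (p ∸ i) (m+[n∸m]≡n (s≤s⁻¹ i≤p)))
... | no i≰p with m≤n⇒∃[o]m+o≡n (≰⇒> i≰p) | m≤n⇒∃[o]m+o≡n p≤k
... | j , refl | q , refl with m≤n⇒∃[o]m+o≡n (+-cancelˡ-< p j (suc q) (subst (p + j <_) (sym (+-suc p q)) (s≤s⁻¹ (s≤s⁻¹ i<))))
-- As i is strictly below the orbit size, at least one descent remains, so the top entry has not yet
-- come down to 1.
... | e , eq = _ , _ , s≤s (s≤s z≤n) ,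
  reindex (+-comm j (2 + p))
    (generic₂ refl (base-Tableau (m≤n⇒m≤1+n p≤k)) j (suc e) (trans (+-suc j e) eq))

special-top : ∀ {k i} → 0 < i → i < 2 + k →
              ∃₂ λ a c → 2 ≤ a × Tableau k a c (iter i (∂ k) (base k (suc k)))
special-top {k} {suc i} _ i< = _ , _ , s≤s (s≤s z≤n) ,
  reindex (+-comm i 1)
    (special (base-Tableau ≤-refl) i (k ∸ i) (m+[n∸m]≡n (s≤s⁻¹ (s≤s⁻¹ i<))))

orbit-top : ∀ {k p i} → p ≤ suc k → 0 < i → i < orbitSize k p →
            ∃₂ λ a c → 2 ≤ a × Tableau k a c (iter i (∂ k) (base k p))
orbit-top {k} {p} p≤ with p ≟ suc k
... | yes refl = special-top
... | no p≢    = generic-top (s≤s⁻¹ (≤∧≢⇒< p≤ p≢))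

orbit-minimal : ∀ {k p i} → p ≤ suc k → 0 < i → i < orbitSize k p → iter i (∂ k) (base k p) ≢ base k p
orbit-minimal p≤ 0<i i< e with orbit-top p≤ 0<i i<
... | a , c , 2≤a , t = contradiction (Tableau-top t (subst (Tableau _ 1 _) (sym e) (base-Tableau p≤))) λ { refl → <-irrefl refl 2≤a }

orbit : ℕ → ℕ → List (List ℕ)
orbit k p = applyUpTo (λ i → iter i (∂ k) (base k p)) (orbitSize k p)

∈-orbit-generic : ∀ {k p i} → p ≤ k → i < 3 + k → iter i (∂ k) (base k p) ∈ orbit k p
∈-orbit-generic {k} {p} {i} p≤k i< =
  ∈-applyUpTo⁺ (λ i → iter i (∂ k) (base k p)) (subst (i <_) (sym (orbitSize-generic p≤k)) i<)

∈-orbit-special : ∀ {k i} → i < 2 + k → iter i (∂ k) (base k (suc k)) ∈ orbit k (suc k)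
∈-orbit-special {k} {i} i< =
  ∈-applyUpTo⁺ (λ i → iter i (∂ k) (base k (suc k))) (subst (i <_) (sym (orbitSize-special k)) i<)

∈-orbit-base : ∀ {k p} → base k p ∈ orbit k p
∈-orbit-base {k} {p} = ∈-applyUpTo⁺ (λ i → iter i (∂ k) (base k p)) (>-nonZero⁻¹ _ {{orbitSize-nonZero k p}})

-- The orbit formulas are inverted. Once a is at least 2, the sign of c - (a+1) tells the case: zero
-- on the exceptional orbit, negative before the bottom entry wraps, positive after it.
Tableau-∈-orbit : ∀ {k a c xs} → Tableau k a c xs → ∃ λ p → p ≤ suc k × xs ∈ orbit k p
Tableau-∈-orbit {k} {a} {c} {xs} t = cases a c t (C.1≤a) C.a≤ C.2≤c C.c≤ C.not-1-2 C.not-both-max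
  where
  module C = Coordinates t
  cases : ∀ a c → Tableau k a c xs → 1 ≤ a → a ≤ 3 + k → 2 ≤ c → c ≤ 4 + k →
          (a ≡ 1 → c ≢ 2) → (a ≡ 3 + k → c ≢ 4 + k) → ∃ λ p → p ≤ suc k × xs ∈ orbit k p
  cases (suc zero) c t _ _ 2≤c c≤ ≢1-2 _ with m≤n⇒∃[o]m+o≡n (≤∧≢⇒< 2≤c (≢1-2 refl ∘ sym))
  ... | p , refl = p , s≤s⁻¹ (s≤s⁻¹ (s≤s⁻¹ c≤)) ,
    subst (_∈ orbit k p) (Tableau-injective (base-Tableau (s≤s⁻¹ (s≤s⁻¹ (s≤s⁻¹ c≤)))) t) ∈-orbit-base
  cases (suc (suc a)) c t _ a≤ 2≤c c≤ _ ≢max with <-cmp c (3 + a)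
  ... | tri≈ _ refl _ = suc k , ≤-refl , subst (_∈ orbit k (suc k))
    (Tableau-injective (special (base-Tableau ≤-refl) (k ∸ a) a (m∸n+n≡m a≤k)) t)
    (∈-orbit-special (subst (_< 2 + k) (+-comm 1 (k ∸ a)) (s≤s (s≤s (m∸n≤m k a)))))
    where
    a≤k : a ≤ k
    -- The pair (m-1 , m) would not fit on the exceptional orbit, but no tableau has it.
    a≤k = s≤s⁻¹ (s≤s⁻¹ (s≤s⁻¹ (≤∧≢⇒< a≤ (λ e → ≢max e (cong suc e)))))
  ... | tri< c< _ _ with m≤n⇒∃[o]m+o≡n 2≤c | m≤n⇒∃[o]m+o≡n (≤∧≢⇒< (s≤s⁻¹ c<) (TableauProperties.top≢bot t ∘ sym)) | m≤n⇒∃[o]m+o≡n a≤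
  ... | e , refl | q , refl | j , eq =
    -- Here j = m-1-a counts the descents since the top entry wrapped, and e = c-2 those still due
    -- before the bottom entry wraps.
    e + j , m≤n⇒m≤1+n p≤k , subst (_∈ orbit k (e + j))
      (Tableau-injective (generic₁ k≡ (base-Tableau (m≤n⇒m≤1+n p≤k)) j e (+-comm j e)) t)
      (∈-orbit-generic p≤k (subst (_< 3 + k) (+-comm 1 j) (s≤s (s≤s (m≤n⇒m≤1+n j≤k)))))
    where
    shuffle : ∀ e q j → e + q + j ≡ e + j + q
    shuffle = solve-∀
    k≡ : k ≡ e + j + q
    k≡ = trans (sym (suc-injective (suc-injective (suc-injective eq)))) (shuffle e q j)
    p≤k : e + j ≤ k
    p≤k = subst (e + j ≤_) (sym k≡) (m≤m+n (e + j) q)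
    j≤k : j ≤ k
    j≤k = ≤-trans (m≤n+m j e) p≤k
  cases (suc (suc a)) c t _ a≤ 2≤c c≤ _ ≢max | tri> _ _ c> with m≤n⇒∃[o]m+o≡n c> | m≤n⇒∃[o]m+o≡n c≤
  ... | p , refl | j , eq =
    -- The difference c - a is constant after the wrap and equals p+2; j = m-c counts the descents
    -- since then.
    p , m≤n⇒m≤1+n p≤k , subst (_∈ orbit k p)
      (Tableau-injective (generic₂ k≡ (base-Tableau (m≤n⇒m≤1+n p≤k)) j (suc a) (trans (+-comm j (suc a)) refl))
        (subst (λ c → Tableau k (2 + a) c xs) (shuffle₂ a p) t))
      (∈-orbit-generic p≤k (subst₂ _<_ (shuffle₃ p j) (cong (λ i → 3 + i) (sym k≡)) (s≤s (s≤s (s≤s (+-monoʳ-≤ p (m≤n+m j a)))))))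
    where
    shuffle₁ : ∀ a p j → a + p + j ≡ p + (a + j)
    shuffle₁ = solve-∀
    shuffle₂ : ∀ a p → 4 + a + p ≡ 3 + p + suc a
    shuffle₂ = solve-∀
    shuffle₃ : ∀ p j → 2 + (p + j) ≡ j + (2 + p)
    shuffle₃ = solve-∀
    k≡ : k ≡ p + (a + j)
    k≡ = trans (sym (suc-injective (suc-injective (suc-injective (suc-injective eq))))) (shuffle₁ a p j)
    p≤k : p ≤ k
    p≤k = subst (p ≤_) (sym k≡) (m≤m+n p (a + j))

orbit-member : ∀ {k p xs} → xs ∈ orbit k p → ∃ λ i → i < orbitSize k p × xs ≡ iter i (∂ k) (base k p)
orbit-member {k} {p} = ∈-applyUpTo⁻ (λ i → iter i (∂ k) (base k p))

orbit-Tableau : ∀ {k p xs} → p ≤ suc k → xs ∈ orbit k p → ∃₂ λ a c → Tableau k a c xs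
orbit-Tableau p≤ x∈ with orbit-member x∈
... | zero  , _  , refl = _ , _ , base-Tableau p≤
... | suc i , i< , refl with orbit-top p≤ z<s i<
... | _ , _ , _ , t = _ , _ , t

-- From the common tableau the first cycle is run to its end, which exhibits `base k p` as an
-- iterate of `base k p′`.
orbit-disjoint : ∀ {k p p′ xs} → p ≤ suc k → p′ ≤ suc k → xs ∈ orbit k p → xs ∈ orbit k p′ → p ≡ p′
orbit-disjoint {k} {p} {p′} p≤ p′≤ x∈ x∈′ with orbit-member x∈ | orbit-member x∈′
... | i , i< , refl | i′ , i′< , e = same (l % n) (m%n<n l n) (trans (sym (iter-mod (∂ k) (orbit-closed p′≤) l)) reach)
  where
  n : ℕ
  n = orbitSize k p′
  instance
    n≢0 : NonZero n
    n≢0 = orbitSize-nonZero k p′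
  l : ℕ
  l = (orbitSize k p ∸ i) + i′
  open ≡-Reasoning
  reach : iter l (∂ k) (base k p′) ≡ base k p
  reach = begin
    iter l (∂ k) (base k p′)                                            ≡⟨ iter-+ (orbitSize k p ∸ i) i′ (∂ k) _ ⟩
    iter (orbitSize k p ∸ i) (∂ k) (iter i′ (∂ k) (base k p′))          ≡⟨ cong (iter (orbitSize k p ∸ i) (∂ k)) e ⟨
    iter (orbitSize k p ∸ i) (∂ k) (iter i (∂ k) (base k p))            ≡⟨ iter-+ (orbitSize k p ∸ i) i (∂ k) _ ⟨
    iter (orbitSize k p ∸ i + i) (∂ k) (base k p)                       ≡⟨ cong (λ j → iter j (∂ k) (base k p)) (m∸n+n≡m (<⇒≤ i<)) ⟩
    iter (orbitSize k p) (∂ k) (base k p)                               ≡⟨ orbit-closed p≤ ⟩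
    base k p                                                            ∎
  -- The base point is the only tableau of an orbit with top entry 1.
  same : ∀ j → j < n → iter j (∂ k) (base k p′) ≡ base k p → p ≡ p′
  same zero    _  eq = +-cancelˡ-≡ 3 p p′ (Tableau-bot (base-Tableau p≤) (subst (Tableau k _ _) eq (base-Tableau p′≤)))
  same (suc j) j< eq with orbit-top p′≤ z<s j<
  ... | a , c , 2≤a , t = contradiction (Tableau-top (subst (Tableau k _ _) eq t) (base-Tableau p≤)) λ { refl → <-irrefl refl 2≤a }

-- The exceptional orbit is listed first, so that every count splits into its term and k+1 = m-3
-- equal ones.
orbitList : ℕ → List (List ℕ)
orbitList k = concatMap (orbit k) (suc k ∷ upTo (suc k))

private
  index≤ : ∀ {k p} → p ∈ suc k ∷ upTo (suc k) → p ≤ suc k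
  index≤ (here refl) = ≤-refl
  index≤ (there i)   = <⇒≤ (∈-upTo⁻ i)

  index∈ : ∀ {k p} → p ≤ suc k → p ∈ suc k ∷ upTo (suc k)
  index∈ p≤ with m≤n⇒m<n∨m≡n p≤
  ... | inj₁ p< = there (∈-upTo⁺ p<)
  ... | inj₂ e  = here e

Unique-orbitList : ∀ k → Unique (orbitList k)
Unique-orbitList k = Unique-concatMap (orbit k) (suc k ∷ upTo (suc k))
  (All.tabulate (λ i e → <⇒≢ (∈-upTo⁻ i) (sym e)) ∷ Unique.upTo⁺ (suc k))
  (λ {p} i → orbit-unique (∂ k) {{orbitSize-nonZero k p}} (orbit-closed (index≤ i)) (orbit-minimal (index≤ i)))
  (λ i j → orbit-disjoint (index≤ i) (index≤ j))

SYT-∈-orbit : ∀ {k xs} → xs ∈ SYT-R (4 + k) → ∃ λ p → p ≤ suc k × xs ∈ orbit k p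
SYT-∈-orbit {k} {xs} i = Tableau-∈-orbit (proj₂ (proj₂ (∈-SYT⇒Tableau {k} {xs} i)))

orbit-∈-SYT : ∀ {k p xs} → p ≤ suc k → xs ∈ orbit k p → xs ∈ SYT-R (4 + k)
orbit-∈-SYT {k} p≤ i = Tableau⇒∈-SYT {k} (proj₂ (proj₂ (orbit-Tableau p≤ i)))

-- Two duplicate-free lists with the same members are permutations of each other.
SYT-↭-orbitList : ∀ k → SYT-R (4 + k) ↭ orbitList k
SYT-↭-orbitList k = ∼bag⇒↭ (unique∧set⇒bag (Unique-SYT k) (Unique-orbitList k) (mk⇔ to from))
  where
  to : ∀ {xs} → xs ∈ SYT-R (4 + k) → xs ∈ orbitList k
  to {xs} i = let p , p≤ , j = SYT-∈-orbit {k} {xs} i in ∈-concatMap⁺ (orbit k) (lose (index∈ p≤) j)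
  from : ∀ {xs} → xs ∈ orbitList k → xs ∈ SYT-R (4 + k)
  from i = let p , j , x∈ = find (∈-concatMap⁻ (orbit k) {xs = suc k ∷ upTo (suc k)} i)
           in orbit-∈-SYT {k} {p} (index≤ j) x∈

-- Counting

module _ {A : Set} (P : A → Bool) where

  count-++ : ∀ xs ys → count P (xs ++ ys) ≡ count P xs + count P ys
  count-++ []       ys = refl
  count-++ (x ∷ xs) ys with P x
  ... | true  = cong suc (count-++ xs ys)
  ... | false = count-++ xs ys

  count-↭ : ∀ {xs ys} → xs ↭ ys → count P xs ≡ count P ys
  count-↭ ↭.refl = refl
  count-↭ (↭.prep x p) with P x
  ... | true  = cong suc (count-↭ p)
  ... | false = count-↭ p
  count-↭ (↭.swap x y p) with P x | P y
  ... | true  | true  = cong (suc ∘ suc) (count-↭ p)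
  ... | true  | false = cong suc (count-↭ p)
  ... | false | true  = cong suc (count-↭ p)
  ... | false | false = count-↭ p
  count-↭ (↭.trans p q) = trans (count-↭ p) (count-↭ q)

  count-const : ∀ {b} xs → (∀ {x} → x ∈ xs → P x ≡ b) → count P xs ≡ (if b then length xs else 0)
  count-const {true}  []       h = refl
  count-const {false} []       h = refl
  count-const {true}  (x ∷ xs) h rewrite h (here refl) = cong suc (count-const xs (h ∘ there))
  count-const {false} (x ∷ xs) h rewrite h (here refl) = count-const xs (h ∘ there)

  count-concatMap : ∀ {B : Set} {n} (f : B → List A) xs → (∀ {x} → x ∈ xs → count P (f x) ≡ n) →
                    count P (concatMap f xs) ≡ length xs * n
  count-concatMap f []       h = refl
  count-concatMap f (x ∷ xs) h = trans (count-++ (f x) (concatMap f xs))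
    (cong₂ _+_ (h (here refl)) (count-concatMap f xs (h ∘ there)))

length-orbit : ∀ k p → length (orbit k p) ≡ orbitSize k p
length-orbit k p = length-applyUpTo _ (orbitSize k p)

-- All counts of the theorem, by period and by fixed points, concern predicates that depend on the
-- orbit size alone.
count-SYT : ∀ {k} (P : List ℕ → Bool) {b : ℕ → Bool} →
  (∀ {p xs} → p ≤ suc k → xs ∈ orbit k p → P xs ≡ b (orbitSize k p)) →
  count P (SYT-R (4 + k)) ≡ (if b (2 + k) then 2 + k else 0) + suc k * (if b (3 + k) then 3 + k else 0)
count-SYT {k} P {b} h = trans (count-↭ P (SYT-↭-orbitList k))
  (trans (count-++ P (orbit k (suc k)) (concatMap (orbit k) (upTo (suc k))))
  (cong₂ _+_ (on-orbit ≤-refl (orbitSize-special k))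
    (trans (count-concatMap P (orbit k) (upTo (suc k))
             (λ i → on-orbit (<⇒≤ (∈-upTo⁻ i)) (orbitSize-generic (s≤s⁻¹ (∈-upTo⁻ i)))))
           (cong (_* (if b (3 + k) then 3 + k else 0)) (length-applyUpTo (λ i → i) (suc k))))))
  where
  on-orbit : ∀ {p n} → p ≤ suc k → orbitSize k p ≡ n → count P (orbit k p) ≡ (if b n then n else 0)
  on-orbit {p} p≤ refl = trans (count-const P (orbit k p) (h p≤))
    (cong (λ l → if b (orbitSize k p) then l else 0) (length-orbit k p))

-- Periods and fixed points through divisibility by the orbit size

==L⇒≡ : ∀ {xs ys} → (xs ==L ys) ≡ true → xs ≡ ys
==L⇒≡ {xs} {ys} h with ≡-dec _≟_ xs ys
... | yes e = e

≡⇒==L : ∀ {xs ys} → xs ≡ ys → (xs ==L ys) ≡ true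
≡⇒==L {xs} {ys} e with ≡-dec _≟_ xs ys
... | yes _ = refl
... | no ≢  = contradiction e ≢

≢⇒==L : ∀ {xs ys} → xs ≢ ys → (xs ==L ys) ≡ false
≢⇒==L ≢ = not-true (≢ ∘ ==L⇒≡)

module _ {m n T} (fixed⇔∣ : ∀ l → iter l (promo m) T ≡ T ⇔ n ∣ l) where
  private
    module F l = Equivalence (fixed⇔∣ l)

  fixed-does : ∀ l → (iter l (promo m) T ==L T) ≡ does (n ∣? l)
  fixed-does l with n ∣? l
  ... | yes n∣l = ≡⇒==L (F.from l n∣l)
  ... | no  n∤l = ≢⇒==L (n∤l ∘ F.to l)

  hasPeriod-size : .{{_ : NonZero n}} → hasPeriod m n T ≡ true
  hasPeriod-size = ∧-true⁺ (T⁻ (<⇒<ᵇ (>-nonZero⁻¹ n)))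
    (∧-true⁺ (≡⇒==L (F.from n ∣-refl)) (allB⁺ _ (map suc (upTo (n ∸ 1))) λ i →
      let j , j∈ , e = ∈-map⁻ suc i
      in subst (λ l → not (iter l (promo m) T ==L T) ≡ true) (sym e) (minimal (∈-upTo⁻ j∈))))
    where
    minimal : ∀ {j} → j < n ∸ 1 → not (iter (suc j) (promo m) T ==L T) ≡ true
    minimal {j} j< = cong not (≢⇒==L λ e → <⇒≱ (below j<) (∣⇒≤ (F.to (suc j) e)))
      where
      below : ∀ {j n} → j < n ∸ 1 → suc j < n
      below {n = suc n} j< = s≤s j<

  hasPeriod-∤ : ∀ {d} → ¬ n ∣ d → hasPeriod m d T ≡ false
  hasPeriod-∤ {d} n∤d = not-true λ h →
    n∤d (F.to d (==L⇒≡ (proj₁ (∧-true⁻ (proj₂ (∧-true⁻ {0 <ᵇ d} h))))))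

promo-fixed⇔∣ : ∀ {k p xs} → p ≤ suc k → xs ∈ orbit k p → ∀ l → iter l (promo (4 + k)) xs ≡ xs ⇔ orbitSize k p ∣ l
promo-fixed⇔∣ {k} {p} p≤ x∈ l with orbit-member x∈
... | i , i< , refl = subst (λ f → iter l f y ≡ y ⇔ orbitSize k p ∣ l) (∂-promo k)
  (mk⇔ (orbit-fixed⇒∣ (∂ k) {{nz}} (orbit-closed p≤) (orbit-minimal p≤) i<)
       (∣⇒orbit-fixed (∂ k) {{nz}} (orbit-closed p≤) (orbit-minimal p≤) {i}))
  where
  y : List ℕ
  y = iter i (∂ k) (base k p)
  nz : NonZero (orbitSize k p)
  nz = orbitSize-nonZero k p

-- The order of promotion and the number of orbits of each size

consecutive-coprime : ∀ n → Coprime n (suc n)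
consecutive-coprime n {d} (d∣n , d∣1+n) = ∣1⇒≡1 (∣m+n∣m⇒∣n (subst (d ∣_) (+-comm 1 n) d∣1+n) d∣n)

consecutive-∣ : ∀ {n l} → n ∣ l → suc n ∣ l → suc n * n ∣ l
consecutive-∣ {n} n∣l (divides q refl) =
  subst (_∣ q * suc n) (*-comm n (suc n))
    (*-monoˡ-∣ (suc n) (coprime-divisor (consecutive-coprime n) (subst (n ∣_) (*-comm q (suc n)) n∣l)))

orbitSize-cases : ∀ k p → orbitSize k p ≡ 2 + k ⊎ orbitSize k p ≡ 3 + k
orbitSize-cases k p with p ≟ suc k
... | yes _ = inj₁ refl
... | no  _ = inj₂ refl

2+k∤3+k : ∀ {k} → ¬ 2 + k ∣ 3 + k
2+k∤3+k {k} h with consecutive-coprime (2 + k) (∣-refl , h)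
... | ()

3+k∤2+k : ∀ {k} → ¬ 3 + k ∣ 2 + k
3+k∤2+k h = <⇒≱ (n<1+n _) (∣⇒≤ h)

orbit-hasPeriod : ∀ {k p xs} → p ≤ suc k → xs ∈ orbit k p → hasPeriod (4 + k) (orbitSize k p) xs ≡ true
orbit-hasPeriod {k} {p} {xs} p≤ i = hasPeriod-size {4 + k} {orbitSize k p} {xs} (promo-fixed⇔∣ p≤ i) {{orbitSize-nonZero k p}}

SYT-periods : ∀ {k xs} → xs ∈ SYT-R (4 + k) → hasPeriod (4 + k) (2 + k) xs ≡ true ⊎ hasPeriod (4 + k) (3 + k) xs ≡ true
SYT-periods {k} {xs} i =
  let p , p≤ , j = SYT-∈-orbit {k} {xs} i
      size n = λ (e : orbitSize k p ≡ n) → subst (λ d → hasPeriod (4 + k) d xs ≡ true) e (orbit-hasPeriod {k} {p} {xs} p≤ j)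
  in Sum.map (size (2 + k)) (size (3 + k)) (orbitSize-cases k p)

-- A tableau has period d exactly when its orbit has size d, provided that no other orbit size
-- divides d.
count-hasPeriod : ∀ {k d} → (∀ p → orbitSize k p ≢ d → ¬ orbitSize k p ∣ d) →
  count (hasPeriod (4 + k) d) (SYT-R (4 + k)) ≡
  (if does (2 + k ≟ d) then 2 + k else 0) + suc k * (if does (3 + k ≟ d) then 3 + k else 0)
count-hasPeriod {k} {d} indivisible = count-SYT {k} (hasPeriod (4 + k) d) {λ n → does (n ≟ d)} value
  where
  value : ∀ {p xs} → p ≤ suc k → xs ∈ orbit k p → hasPeriod (4 + k) d xs ≡ does (orbitSize k p ≟ d)
  value {p} {xs} p≤ i = by (orbitSize k p ≟ d)
    where
    by : (eq? : Dec (orbitSize k p ≡ d)) → hasPeriod (4 + k) d xs ≡ does eq?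
    by (yes e) = subst (λ n → hasPeriod (4 + k) n xs ≡ true) e (orbit-hasPeriod {k} {p} {xs} p≤ i)
    by (no ≢)  = hasPeriod-∤ {4 + k} {orbitSize k p} {xs} (promo-fixed⇔∣ p≤ i) (indivisible p ≢)

count-special : ∀ k → count (hasPeriod (4 + k) (2 + k)) (SYT-R (4 + k)) ≡ 1 * (2 + k)
count-special k = trans (count-hasPeriod {k} {2 + k} indivisible)
  (trans (cong₂ (λ b b′ → (if b then 2 + k else 0) + suc k * (if b′ then 3 + k else 0))
           (dec-true (2 + k ≟ 2 + k) refl) (dec-false (3 + k ≟ 2 + k) λ ()))
         (cong (λ x → 2 + k + x) (*-zeroʳ (suc k))))
  where
  indivisible : ∀ p → orbitSize k p ≢ 2 + k → ¬ orbitSize k p ∣ 2 + k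
  indivisible p ≢ with orbitSize k p | orbitSize-cases k p
  ... | _ | inj₁ e    = contradiction e ≢
  ... | _ | inj₂ refl = 3+k∤2+k

count-generic : ∀ k → count (hasPeriod (4 + k) (3 + k)) (SYT-R (4 + k)) ≡ suc k * (3 + k)
count-generic k = trans (count-hasPeriod {k} {3 + k} indivisible)
  (cong₂ (λ b b′ → (if b then 2 + k else 0) + suc k * (if b′ then 3 + k else 0))
         (dec-false (2 + k ≟ 3 + k) λ ()) (dec-true (3 + k ≟ 3 + k) refl))
  where
  indivisible : ∀ p → orbitSize k p ≢ 3 + k → ¬ orbitSize k p ∣ 3 + k
  indivisible p ≢ with orbitSize k p | orbitSize-cases k p
  ... | _ | inj₁ refl = 2+k∤3+k
  ... | _ | inj₂ e    = contradiction e ≢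

SYT-order : ∀ {k xs} → xs ∈ SYT-R (4 + k) → iter ((3 + k) * (2 + k)) (promo (4 + k)) xs ≡ xs
SYT-order {k} {xs} i =
  let p , p≤ , j = SYT-∈-orbit {k} {xs} i
  in Equivalence.from (promo-fixed⇔∣ {k} {p} {xs} p≤ j ((3 + k) * (2 + k))) (size p)
  where
  size : ∀ p → orbitSize k p ∣ (3 + k) * (2 + k)
  size p with orbitSize k p | orbitSize-cases k p
  ... | _ | inj₁ refl = n∣m*n (3 + k)
  ... | _ | inj₂ refl = m∣m*n (2 + k)

moved : ∀ {k p} l → p ≤ suc k → ¬ orbitSize k p ∣ l →
        ∃ λ T → T ∈ SYT-R (4 + k) × ¬ (iter l (promo (4 + k)) T ≡ T)
moved {k} {p} l p≤ ∤ = base k p , orbit-∈-SYT {k} {p} p≤ ∈-orbit-base ,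
  λ e → ∤ (Equivalence.to (promo-fixed⇔∣ {k} {p} p≤ ∈-orbit-base l) e)

-- If m-2 does not divide l, the exceptional base point moves; if m-1 does not, the base point with
-- p = 0 moves. Otherwise the product divides l, which is too small for that.
SYT-order-minimal : ∀ {k} l → 0 < l → l < (3 + k) * (2 + k) →
                    ∃ λ T → T ∈ SYT-R (4 + k) × ¬ (iter l (promo (4 + k)) T ≡ T)
SYT-order-minimal {k} l 0<l l< = by (2 + k ∣? l) (3 + k ∣? l)
  where
  by : Dec (2 + k ∣ l) → Dec (3 + k ∣ l) → ∃ λ T → T ∈ SYT-R (4 + k) × ¬ (iter l (promo (4 + k)) T ≡ T)
  by (no ∤)   _         = moved l ≤-refl (subst (λ n → ¬ n ∣ l) (sym (orbitSize-special k)) ∤)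
  by (yes _)  (no ∤)    = moved {k} {0} l z≤n (subst (λ n → ¬ n ∣ l) (sym (orbitSize-generic {k} z≤n)) ∤)
  by (yes ∣l) (yes ∣l′) = contradiction (∣⇒≤ {{>-nonZero 0<l}} (consecutive-∣ ∣l ∣l′)) (<⇒≱ l<)

-- Both sides of the sieving identity are built from this number: it counts the points of an n-cycle
-- fixed by its l-th power, and it is [n] at the l-th power of a primitive n-th root of unity.
multiple : ℕ → ℕ → ℕ
multiple n l = if does (n ∣? l) then n else 0

fixCount-multiple : ∀ k l → fixCount (4 + k) l ≡ multiple (2 + k) ℤ.∣ l ∣ + suc k * multiple (3 + k) ℤ.∣ l ∣
fixCount-multiple k l = count-SYT {k} _ {λ n → does (n ∣? ℤ.∣ l ∣)}
  λ {p} {xs} p≤ i → fixed-does {4 + k} {orbitSize k p} {xs} (promo-fixed⇔∣ p≤ i) ℤ.∣ l ∣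

∣-shift : ∀ n q s → n ∣ ℤ.∣ q ℤ.* + n ℤ.+ s ∣ ⇔ n ∣ ℤ.∣ s ∣
∣-shift n q s = mk⇔
  (λ h → ℤ∣.∣⇒∣ᵤ {+ n} {s} (ℤ∣.∣m+n∣m⇒∣n (ℤ∣.∣ᵤ⇒∣ {+ n} {q ℤ.* + n ℤ.+ s} h) n∣qn))
  (λ h → ℤ∣.∣⇒∣ᵤ {+ n} {q ℤ.* + n ℤ.+ s} (ℤ∣.∣m∣n⇒∣m+n n∣qn (ℤ∣.∣ᵤ⇒∣ {+ n} {s} h)))
  where
  n∣qn : + n ℤ∣.∣ q ℤ.* + n
  n∣qn = ℤ∣.divides q refl

multiple-shift : ∀ n q s → multiple n ℤ.∣ q ℤ.* + n ℤ.+ s ∣ ≡ multiple n ℤ.∣ s ∣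
multiple-shift n q s = cong (λ b → if b then n else 0) (does-⇔ (∣-shift n q s) (n ∣? ℤ.∣ q ℤ.* + n ℤ.+ s ∣) (n ∣? ℤ.∣ s ∣))

-- The exponent r(m-2)+s(m-1) is s modulo m-2 and -r modulo m-1. This is why t = ζ^s governs the
-- orbit of size m-2 and q = ξ^r the others.
fixCount-combination : ∀ k r s →
  fixCount (4 + k) (r ℤ.* + (2 + k) ℤ.+ s ℤ.* + (3 + k)) ≡ multiple (2 + k) ℤ.∣ s ∣ + suc k * multiple (3 + k) ℤ.∣ r ∣
fixCount-combination k r s = trans (fixCount-multiple k (r ℤ.* + (2 + k) ℤ.+ s ℤ.* + (3 + k))) (cong₂ (λ x y → x + suc k * y)
  (trans (cong (multiple (2 + k) ∘ ℤ.∣_∣) (split₁ r s (+ (2 + k)))) (multiple-shift (2 + k) (r ℤ.+ s) s))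
  (trans (cong (multiple (3 + k) ∘ ℤ.∣_∣) (split₂ r s (+ (2 + k))))
  (trans (multiple-shift (3 + k) (r ℤ.+ s) (ℤ.- r)) (cong (multiple (3 + k)) (ℤ.∣-i∣≡∣i∣ r)))))
  where
  split₁ : ∀ r s n → r ℤ.* n ℤ.+ s ℤ.* (+ 1 ℤ.+ n) ≡ (r ℤ.+ s) ℤ.* n ℤ.+ s
  split₁ = ℤSolver.solve-∀
  split₂ : ∀ r s n → r ℤ.* n ℤ.+ s ℤ.* (+ 1 ℤ.+ n) ≡ (r ℤ.+ s) ℤ.* (+ 1 ℤ.+ n) ℤ.+ (ℤ.- r)
  split₂ = ℤSolver.solve-∀

-- The bicyclic sieving identity

module _ {c ℓ} (R : CommutativeRing c ℓ) where
  open RingDefs R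
  open RootsOfUnity R
  private module R = CommutativeRing R

  sieving : ∀ k → NoZeroDivisors → ∀ {ξ ξ⁻¹ ζ ζ⁻¹} →
    IsPrimitiveRoot (3 + k) ξ → ξ R.* ξ⁻¹ R.≈ R.1# → IsPrimitiveRoot (2 + k) ζ → ζ R.* ζ⁻¹ R.≈ R.1# →
    ∀ r s → ψ (4 + k) (zpow ξ ξ⁻¹ r) (zpow ζ ζ⁻¹ s) R.≈ natC (fixCount (4 + k) (r ℤ.* + (2 + k) ℤ.+ s ℤ.* + (3 + k)))
  sieving k nzd {ξ} {ξ⁻¹} {ζ} {ζ⁻¹} ξ-prim ξ-inv ζ-prim ζ-inv r s = begin
    qint (2 + k) (zpow ζ ζ⁻¹ s) R.+ natC (suc k) R.* qint (3 + k) (zpow ξ ξ⁻¹ r)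
      ≈⟨ R.+-cong (qint-zpow nzd ζ-prim ζ-inv s) (R.*-congˡ (qint-zpow nzd ξ-prim ξ-inv r)) ⟩
    natC (multiple (2 + k) ℤ.∣ s ∣) R.+ natC (suc k) R.* natC (multiple (3 + k) ℤ.∣ r ∣)
      ≈⟨ R.+-congˡ (natC-* (suc k) (multiple (3 + k) ℤ.∣ r ∣)) ⟨
    natC (multiple (2 + k) ℤ.∣ s ∣) R.+ natC (suc k * multiple (3 + k) ℤ.∣ r ∣)
      ≈⟨ natC-+ (multiple (2 + k) ℤ.∣ s ∣) (suc k * multiple (3 + k) ℤ.∣ r ∣) ⟨
    natC (multiple (2 + k) ℤ.∣ s ∣ + suc k * multiple (3 + k) ℤ.∣ r ∣)
      ≡⟨ cong natC (fixCount-combination k r s) ⟨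
    natC (fixCount (4 + k) (r ℤ.* + (2 + k) ℤ.+ s ℤ.* + (3 + k))) ∎
    where open import Relation.Binary.Reasoning.Setoid R.setoid

-- m ∸ 1, m ∸ 2 and m ∸ 3 are variables here, so that no comparison of iterates unfolds promo.
Sieving : ∀ c ℓ (m n₁ n₂ n₃ : ℕ) → Set (Level.suc (c ⊔ ℓ))
Sieving c ℓ m n₁ n₂ n₃ =
    ((∀ T → T ∈ SYT-R m → iter (n₁ * n₂) (promo m) T ≡ T)
    × (∀ k → 0 < k → k < n₁ * n₂ → ∃ λ T → (T ∈ SYT-R m) × ¬ (iter k (promo m) T ≡ T)))
    × (∀ T → T ∈ SYT-R m → (hasPeriod m n₂ T ≡ true) ⊎ (hasPeriod m n₁ T ≡ true))
    × (count (hasPeriod m n₂) (SYT-R m) ≡ 1 * n₂)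
    × (count (hasPeriod m n₁) (SYT-R m) ≡ n₃ * n₁)
    × ((R : CommutativeRing c ℓ) →
    let open RingDefs R in
    NoZeroDivisors →
    ∀ ξ ξ⁻¹ ζ ζ⁻¹ → IsPrimitiveRoot n₁ ξ → CommutativeRing._≈_ R (CommutativeRing._*_ R ξ ξ⁻¹) (CommutativeRing.1# R) →
    IsPrimitiveRoot n₂ ζ → CommutativeRing._≈_ R (CommutativeRing._*_ R ζ ζ⁻¹) (CommutativeRing.1# R) →
    ∀ (r s : ℤ) →
    CommutativeRing._≈_ R (ψ m (zpow ξ ξ⁻¹ r) (zpow ζ ζ⁻¹ s))
    (natC (fixCount m (r ℤ.* + n₂ ℤ.+ s ℤ.* + n₁))))

ribbon-sieving : ∀ {c ℓ m n₁ n₂ n₃} k → m ≡ 4 + k → n₁ ≡ 3 + k → n₂ ≡ 2 + k → n₃ ≡ suc k → Sieving c ℓ m n₁ n₂ n₃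
ribbon-sieving k refl refl refl refl =
  ((λ T → SYT-order {k} {T}) , SYT-order-minimal {k})
  , (λ T → SYT-periods {k} {T})
  , count-special k
  , count-generic k
  , λ R nzd ξ ξ⁻¹ ζ ζ⁻¹ ξ-prim ξ-inv ζ-prim ζ-inv → sieving R k nzd ξ-prim ξ-inv ζ-prim ζ-inv

mainTheorem17 : ∀ {c ℓ : Level} (m : ℕ) → 3 < m →
  -- promotion has order (m-1)(m-2)
  ((∀ T → T ∈ SYT-R m → iter ((m ∸ 1) * (m ∸ 2)) (promo m) T ≡ T)
   × (∀ k → 0 < k → k < (m ∸ 1) * (m ∸ 2) → ∃ λ T → (T ∈ SYT-R m) × ¬ (iter k (promo m) T ≡ T)))
  -- orbits: every orbit has size m-2 or m-1; one orbit of size m-2, m-3 of size m-1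
  × (∀ T → T ∈ SYT-R m → (hasPeriod m (m ∸ 2) T ≡ true) ⊎ (hasPeriod m (m ∸ 1) T ≡ true))
  × (count (hasPeriod m (m ∸ 2)) (SYT-R m) ≡ 1 * (m ∸ 2))
  × (count (hasPeriod m (m ∸ 1)) (SYT-R m) ≡ (m ∸ 3) * (m ∸ 1))
  -- bicyclic sieving
  × ((R : CommutativeRing c ℓ) →
      let open RingDefs R in
      NoZeroDivisors →
      ∀ ξ ξ⁻¹ ζ ζ⁻¹ → IsPrimitiveRoot (m ∸ 1) ξ → CommutativeRing._≈_ R (CommutativeRing._*_ R ξ ξ⁻¹) (CommutativeRing.1# R) →
      IsPrimitiveRoot (m ∸ 2) ζ → CommutativeRing._≈_ R (CommutativeRing._*_ R ζ ζ⁻¹) (CommutativeRing.1# R) →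
      ∀ (r s : ℤ) →
      CommutativeRing._≈_ R (ψ m (zpow ξ ξ⁻¹ r) (zpow ζ ζ⁻¹ s))
        (natC (fixCount m (r ℤ.* + (m ∸ 2) ℤ.+ s ℤ.* + (m ∸ 1)))))
mainTheorem17 m 3<m with m≤n⇒∃[o]m+o≡n 3<m
... | k , eq = ribbon-sieving k (sym eq) (cong (_∸ 1) (sym eq)) (cong (_∸ 2) (sym eq)) (cong (_∸ 3) (sym eq))
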